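{- Let $(G,\theta)$ be a $2$-oriented profinite group satisfying formal Hilbert 90 and let $\chi_1,\chi_2,\chi_3\in H^1(G,\mathbb Z/2\mathbb Z)$. If the mod $2$ Massey product $\langle\chi_1,\chi_2,\chi_3,\chi_1\rangle$ is defined, then it vanishes.
   Context: A $p$-oriented profinite group is a pair $(G,\theta)$ with $G$ a profinite group and $\theta\colon G\to\mathbb Z_p^\times$ a continuous homomorphism. For $n\geq 1$, $\mathbb Z/p^n\mathbb Z(1)$ denotes the discrete $G$-module $\mathbb Z/p^n\mathbb Z$ with $g\cdot v=\theta(g)v$. $(G,\theta)$ satisfies formal Hilbert 90 if for every open subgroup $H\subset G$ and every $n\geq1$ the reduction map $H^1(H,\mathbb Z/p^n\mathbb Z(1))\to H^1(H,\mathbb Z/p\mathbb Z(1))$ is surjective. Here $p=2$ and $\mathbb Z/2\mathbb Z$ has trivial action. Massey products: For a differential graded ring $(A,\partial)$ and $a_1,\dots,a_n\in H^1(A)$, a defining system for $\langle a_1,\dots,a_n\rangle$ is a collection of elements $a_{ij}\in A^1$, $1\le i<j\le n+1$, $(i,j)\ne(1,n+1)$, with $\partial a_{i,i+1}=0$, $a_{i,i+1}$ representing $a_i$, and $\partial(a_{ij})=-\sum_{l=i+1}^{j-1}a_{il}a_{lj}$ for $i<j-1$; its value is the class of $-\sum_{l=2}^n a_{1l}a_{l,n+1}$ in $H^2(A)$. The Massey product $\langle a_1,\dots,a_n\rangle\subset H^2(A)$ is the set of all values of defining systems; it is defined if nonempty and vanishes if it contains $0$. Mod $2$ Massey products for $G$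 are taken in the differential graded ring of continuous inhomogeneous cochains $C^*(G,\mathbb Z/2\mathbb Z)$ with cup product. -}

module Defs where

open import Algebra.Bundles using (Group; AbelianGroup; CommutativeMonoid; CommutativeRing)
open import Algebra.Morphism.Structures using (IsGroupHomomorphism)
open import Data.Fin.Base as Fin using (Fin; toℕ)
open import Data.Integer.Base as ℤ using (ℤ; +_; 0ℤ; 1ℤ)
open import Data.Integer.Divisibility.Signed as ℤ∣ using (_∣_; divides)
open import Data.Integer.Tactic.RingSolver using (solve-∀)
import Data.Integer.Properties as ℤ
open import Data.List.Base as List using (List; applyUpTo)
open import Data.List.Relation.Unary.Any using (Any)
open import Data.Nat.Base as ℕ using (ℕ; zero; suc; _^_; _∸_; _≤_; _<_)
import Data.Nat.Properties as ℕ
open import Data.Product.Base using (Σ; ∃; ∃₂; Σ-syntax; ∃-syntax; _×_; _,_; proj₁; proj₂)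
open import Data.Sum.Base using (_⊎_)
open import Data.Unit.Polymorphic.Base using (⊤; tt)
open import Data.Vec.Base as Vec using (Vec; []; _∷_; head; tail; init; take; drop; lookup; zipWith)
open import Data.Vec.Relation.Binary.Pointwise.Inductive as PW using (Pointwise; []; _∷_)
open import Data.Vec.Relation.Unary.All using (All; []; _∷_)
open import Function.Base using (_∘_; id)
open import Function.Definitions using (Surjective)
open import Level using (Level; Lift; _⊔_; 0ℓ) renaming (suc to lsuc)
open import Relation.Binary.Core using (Rel)
open import Relation.Binary.Definitions using (_Respects_)
open import Relation.Binary.PropositionalEquality as ≡ using (_≡_)
open import Relation.Nullary.Negation.Core using (¬_)
open import Relation.Unary using (Pred; _∈_; _⊆_; _≐_; _∩_; _∪_; ⋃; Empty)

import Algebra.Properties.AbelianGroup as AbelianGroupProperties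
import Algebra.Properties.CommutativeMonoid.Sum as Sum
import Algebra.Properties.CommutativeSemigroup as CommutativeSemigroupProperties
import Relation.Binary.Reasoning.Setoid as SetoidReasoning

private
  variable
    u m r m′ r′ : Level
    n k : ℕ

------------------------------------------------------------------------
-- Topological and profinite groups

record TopologicalGroup (u : Level) : Set (lsuc (lsuc u)) where
  field
    group : Group u u

  open Group group public

  field
    IsOpen       : Pred Carrier u → Set (lsuc u)
    open-resp-≈  : ∀ {U} → IsOpen U → U Respects _≈_
    open-resp-≐  : ∀ {U V} → U ≐ V → IsOpen U → IsOpen V
    open-⊤       : IsOpen (λ _ → ⊤)
    open-∩       : ∀ {U V} → IsOpen U → IsOpen V → IsOpen (U ∩ V)
    open-⋃       : ∀ {I : Set u} {U : I → Pred Carrier u} →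
                   (∀ i → IsOpen (U i)) → IsOpen (⋃ I U)
    ∙-continuous : ∀ {W} → IsOpen W → ∀ x y → x ∙ y ∈ W →
                   ∃₂ λ U V → IsOpen U × IsOpen V × x ∈ U × y ∈ V ×
                   (∀ {x′ y′} → x′ ∈ U → y′ ∈ V → x′ ∙ y′ ∈ W)
    ⁻¹-continuous : ∀ {U} → IsOpen U → IsOpen (λ x → x ⁻¹ ∈ U)

module _ (G : TopologicalGroup u) where
  open TopologicalGroup G

  Compact : Set (lsuc u)
  Compact = ∀ {I : Set u} (U : I → Pred Carrier u) → (∀ i → IsOpen (U i)) →
            (∀ x → ∃[ i ] x ∈ U i) →
            Σ[ is ∈ List I ] (∀ x → Any (λ i → x ∈ U i) is)

  Hausdorff : Set (lsuc u)
  Hausdorff = ∀ x y → ¬ x ≈ y →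
              ∃₂ λ U V → IsOpen U × IsOpen V × x ∈ U × y ∈ V × Empty (U ∩ V)

  Connected : Pred (Pred Carrier u) (lsuc u)
  Connected S = ∀ {U V} → IsOpen U → IsOpen V → S ⊆ U ∪ V → Empty (S ∩ (U ∩ V)) →
                S ⊆ U ⊎ S ⊆ V

  TotallyDisconnected : Set (lsuc u)
  TotallyDisconnected = ∀ {S} → Connected S → ∀ {x y} → x ∈ S → y ∈ S → x ≈ y

record ProfiniteGroup (u : Level) : Set (lsuc (lsuc u)) where
  field
    topologicalGroup    : TopologicalGroup u
    compact             : Compact topologicalGroup
    hausdorff           : Hausdorff topologicalGroup
    totallyDisconnected : TotallyDisconnected topologicalGroup

  open TopologicalGroup topologicalGroup public

record OpenSubgroup (G : TopologicalGroup u) : Set (lsuc u) where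
  open TopologicalGroup G
  field
    member    : Pred Carrier u
    isOpen    : IsOpen member
    ε-closed  : ε ∈ member
    ∙-closed  : ∀ {x y} → x ∈ member → y ∈ member → x ∙ y ∈ member
    ⁻¹-closed : ∀ {x} → x ∈ member → x ⁻¹ ∈ member

  -- The subgroup with the subspace topology.
  topologicalGroup : TopologicalGroup u
  topologicalGroup = record
    { group = record
      { Carrier = ∃ member
      ; _≈_ = λ x y → proj₁ x ≈ proj₁ y
      ; _∙_ = λ x y → proj₁ x ∙ proj₁ y , ∙-closed (proj₂ x) (proj₂ y)
      ; ε = ε , ε-closed
      ; _⁻¹ = λ x → proj₁ x ⁻¹ , ⁻¹-closed (proj₂ x)
      ; isGroup = record
        { isMonoid = record
          { isSemigroup = record
            { isMagma = record
              { isEquivalence = record { refl = refl ; sym = sym ; trans = trans }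
              ; ∙-cong = ∙-cong
              }
            ; assoc = λ x y z → assoc (proj₁ x) (proj₁ y) (proj₁ z)
            }
          ; identity = (λ x → identityˡ (proj₁ x)) , (λ x → identityʳ (proj₁ x))
          }
        ; inverse = (λ x → inverseˡ (proj₁ x)) , (λ x → inverseʳ (proj₁ x))
        ; ⁻¹-cong = ⁻¹-cong
        }
      }
    ; IsOpen = λ V → Σ[ U ∈ Pred Carrier u ] IsOpen U × V ≐ (U ∘ proj₁)
    ; open-resp-≈ = λ (U , Uo , V⊆U , U⊆V) x≈y Vx → U⊆V (open-resp-≈ Uo x≈y (V⊆U Vx))
    ; open-resp-≐ = λ (V⊆W , W⊆V) (U , Uo , V⊆U , U⊆V) →
        U , Uo , (λ w → V⊆U (W⊆V w)) , (λ w → V⊆W (U⊆V w))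
    ; open-⊤ = (λ _ → ⊤) , open-⊤ , id , id
    ; open-∩ = λ (U , Uo , V⊆U , U⊆V) (U′ , Uo′ , V⊆U′ , U⊆V′) →
        U ∩ U′ , open-∩ Uo Uo′
        , (λ (a , b) → V⊆U a , V⊆U′ b) , (λ (a , b) → U⊆V a , U⊆V′ b)
    ; open-⋃ = λ {I} W →
        ⋃ I (λ i → proj₁ (W i)) , open-⋃ (λ i → proj₁ (proj₂ (W i)))
        , (λ (i , a) → i , proj₁ (proj₂ (proj₂ (W i))) a)
        , (λ (i , a) → i , proj₂ (proj₂ (proj₂ (W i))) a)
    ; ∙-continuous = λ (U , Uo , W⊆U , U⊆W) x y xy∈W →
        let A , B , Ao , Bo , x∈A , y∈B , AB⊆U =
              ∙-continuous Uo (proj₁ x) (proj₁ y) (W⊆U xy∈W)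
        in A ∘ proj₁ , B ∘ proj₁ , (A , Ao , id , id) , (B , Bo , id , id)
           , x∈A , y∈B , (λ a b → U⊆W (AB⊆U a b))
    ; ⁻¹-continuous = λ (U , Uo , V⊆U , U⊆V) →
        (λ x → x ⁻¹ ∈ U) , ⁻¹-continuous Uo , (λ a → V⊆U a) , (λ a → U⊆V a)
    }

------------------------------------------------------------------------
-- Discrete modules

record DiscreteModule (G : TopologicalGroup u) (m r : Level) :
                      Set (lsuc (u ⊔ m ⊔ r)) where
  private module G = TopologicalGroup G
  field
    abelianGroup : AbelianGroup m r

  open AbelianGroup abelianGroup public
    renaming (_∙_ to infixl 6 _+_; ε to 0#; _⁻¹ to infix 8 -_; ∙-cong to +-cong; ⁻¹-cong to -‿cong)

  infixr 7 _·_
  field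
    _·_        : G.Carrier → Carrier → Carrier
    ·-cong     : ∀ {g h v w} → g G.≈ h → v ≈ w → g · v ≈ h · w
    ·-identity : ∀ v → G.ε · v ≈ v
    ·-assoc    : ∀ g h v → (g G.∙ h) · v ≈ g · (h · v)
    ·-distrib  : ∀ g v w → g · (v + w) ≈ g · v + g · w
    ·-continuous : ∀ g v → ∃[ U ] (G.IsOpen U × g ∈ U × (∀ {h} → h ∈ U → h · v ≈ g · v))

record ModuleHom {G : TopologicalGroup u} (M : DiscreteModule G m r)
                 (N : DiscreteModule G m′ r′) : Set (u ⊔ m ⊔ r ⊔ m′ ⊔ r′) where
  private
    module G = TopologicalGroup G
    module M = DiscreteModule M
    module N = DiscreteModule N
  field
    ⟦_⟧    : M.Carrier → N.Carrier
    ⟦⟧-cong : ∀ {v w} → v M.≈ w → ⟦ v ⟧ N.≈ ⟦ w ⟧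
    +-homo : ∀ v w → ⟦ v M.+ w ⟧ N.≈ ⟦ v ⟧ N.+ ⟦ w ⟧
    ·-homo : ∀ g v → ⟦ g M.· v ⟧ N.≈ g N.· ⟦ v ⟧

module _ {G : TopologicalGroup u} (H : OpenSubgroup G) where
  private module H = OpenSubgroup H

  restrict : DiscreteModule G m r → DiscreteModule H.topologicalGroup m r
  restrict M = record
    { abelianGroup = M.abelianGroup
    ; _·_ = λ h v → proj₁ h M.· v
    ; ·-cong = M.·-cong
    ; ·-identity = M.·-identity
    ; ·-assoc = λ g h → M.·-assoc (proj₁ g) (proj₁ h)
    ; ·-distrib = λ g → M.·-distrib (proj₁ g)
    ; ·-continuous = λ g v →
        let U , Uo , g∈U , c = M.·-continuous (proj₁ g) v
        in U ∘ proj₁ , (U , Uo , id , id) , g∈U , λ h∈U → c h∈U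
    }
    where module M = DiscreteModule M

  restrictHom : {M : DiscreteModule G m r} {N : DiscreteModule G m′ r′} →
                ModuleHom M N → ModuleHom (restrict M) (restrict N)
  restrictHom f = record
    { ⟦_⟧ = f.⟦_⟧
    ; ⟦⟧-cong = f.⟦⟧-cong
    ; +-homo = f.+-homo
    ; ·-homo = λ g → f.·-homo (proj₁ g)
    }
    where module f = ModuleHom f

trivialModule : (G : TopologicalGroup u) → AbelianGroup m r → DiscreteModule G m r
trivialModule G A = record
  { abelianGroup = A
  ; _·_ = λ _ v → v
  ; ·-cong = λ _ e → e
  ; ·-identity = λ _ → A.refl
  ; ·-assoc = λ _ _ _ → A.refl
  ; ·-distrib = λ _ _ _ → A.refl
  ; ·-continuous = λ _ _ → (λ _ → ⊤) , open-⊤ , tt , λ _ → A.refl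
  }
  where
  module A = AbelianGroup A
  open TopologicalGroup G

------------------------------------------------------------------------
-- Cochain complexes, differential graded rings, Massey products

-- A graded abelian group with an additive map of degree one.  The condition
-- ∂ ∘ ∂ = 0 is not needed to state anything below.
record RawComplex (m r : Level) : Set (lsuc (m ⊔ r)) where
  field
    degree : ℕ → AbelianGroup m r

  C : ℕ → Set m
  C n = AbelianGroup.Carrier (degree n)

  field
    ∂      : C n → C (suc n)
    ∂-homo : IsGroupHomomorphism (AbelianGroup.rawGroup (degree n))
                                 (AbelianGroup.rawGroup (degree (suc n))) ∂

  module _ {n : ℕ} where
    open AbelianGroup (degree n) public
      using (_≈_)
      renaming (_∙_ to infixl 6 _+_; ε to 0#; _⁻¹ to infix 8 -_)

  IsCocycle : Pred (C n) r
  IsCocycle a = ∂ a ≈ 0#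

  IsCoboundary : Pred (C n) (m ⊔ r)
  IsCoboundary {zero}  a = Lift m (a ≈ 0#)
  IsCoboundary {suc n} a = ∃[ b ] ∂ b ≈ a

  infix 4 _∼_
  _∼_ : Rel (C n) (m ⊔ r)
  a ∼ b = IsCoboundary (a + - b)

  -- The cohomology group in degree n is represented by the n-cocycles,
  -- compared by _≈H_.
  H : ℕ → Set (m ⊔ r)
  H n = Σ (C n) IsCocycle

  infix 4 _≈H_
  _≈H_ : Rel (H n) (m ⊔ r)
  a ≈H b = proj₁ a ∼ proj₁ b

  0H : H n
  0H = 0# , IsGroupHomomorphism.ε-homo ∂-homo

-- The operations of a differential graded ring that enter the definition of
-- Massey products; none of the ring laws does.
record RawDGRing (m r : Level) : Set (lsuc (m ⊔ r)) where
  field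
    complex : RawComplex m r

  open RawComplex complex public

  infixl 7 _⌣_
  field
    _⌣_ : C n → C k → C (n ℕ.+ k)

  -- the sum of f l over i < l < j
  ∑between : ℕ → ℕ → (ℕ → C n) → C n
  ∑between i j f = List.foldr _+_ 0# (applyUpTo (λ t → f (suc i ℕ.+ t)) (j ∸ suc i))

  -- Indices are numbered from 1.  Only the entries a i j with
  -- 1 ≤ i < j ≤ n+1 and (i,j) ≠ (1,n+1) are constrained or used.
  record IsDefiningSystem {n : ℕ} (χ : Vec (H 1) n) (a : ℕ → ℕ → C 1) :
                          Set (m ⊔ r) where
    field
      cocycle    : (i : Fin n) → IsCocycle (a (suc (toℕ i)) (suc (suc (toℕ i))))
      represents : (i : Fin n) → a (suc (toℕ i)) (suc (suc (toℕ i))) ∼ proj₁ (lookup χ i)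
      boundary   : ∀ i j → 1 ≤ i → suc i < j → j ≤ suc n → ¬ (i ≡ 1 × j ≡ suc n) →
                   ∂ (a i j) ≈ - ∑between i j (λ l → a i l ⌣ a l j)

  value : ℕ → (ℕ → ℕ → C 1) → C 2
  value n a = - ∑between 1 (suc n) (λ l → a 1 l ⌣ a l (suc n))

  ⟨_⟩ : Vec (H 1) n → Pred (H 2) (m ⊔ r)
  ⟨_⟩ {n} χ β = ∃[ a ] IsDefiningSystem χ a × value n a ∼ proj₁ β

  MasseyDefined : Vec (H 1) n → Set (m ⊔ r)
  MasseyDefined χ = ∃[ β ] β ∈ ⟨ χ ⟩

  MasseyVanishes : Vec (H 1) n → Set (m ⊔ r)
  MasseyVanishes χ = 0H ∈ ⟨ χ ⟩

------------------------------------------------------------------------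
-- Continuous inhomogeneous cochains

module _ (G : TopologicalGroup u) where
  open TopologicalGroup G

  -- P holds on a neighbourhood of x for the product topology on Gⁿ
  record Near {n : ℕ} (x : Vec Carrier n) (P : Pred (Vec Carrier n) r) : Set (lsuc u ⊔ r) where
    constructor near
    field
      box    : Vec (Pred Carrier u) n
      isOpen : All IsOpen box
      x∈box  : Pointwise _∈_ x box
      holds  : ∀ {y} → Pointwise _∈_ y box → P y

  contract : Fin n → Vec Carrier (suc n) → Vec Carrier n
  contract Fin.zero    (x ∷ y ∷ xs) = x ∙ y ∷ xs
  contract (Fin.suc i) (x ∷ xs)     = x ∷ contract i xs

module _ {G : TopologicalGroup u} where
  open TopologicalGroup G

  private
    _∈*_ : Vec Carrier n → Vec (Pred Carrier u) n → Set (lsuc u)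
    _∈*_ = Pointwise _∈_

    Continuous : (Vec Carrier n → Vec Carrier k) → Set (lsuc u)
    Continuous φ = ∀ x {Us} → All IsOpen Us → φ x ∈* Us → Near G x (λ y → φ y ∈* Us)

  near-map : ∀ {x : Vec Carrier n} {P : Pred (Vec Carrier n) r} {Q : Pred (Vec Carrier n) r′} →
             P ⊆ Q → Near G x P → Near G x Q
  near-map f (near Us o x∈ p) = near Us o x∈ λ y∈ → f (p y∈)

  near-⊤ : (x : Vec Carrier n) → Near G x (λ _ → ⊤ {r})
  near-⊤ []       = near [] [] [] _
  near-⊤ (x ∷ xs) =
    let near Us o xs∈ _ = near-⊤ {r = 0ℓ} xs
    in near ((λ _ → ⊤) ∷ Us) (open-⊤ ∷ o) (tt ∷ xs∈) _

  near-always : ∀ (x : Vec Carrier n) {P : Pred (Vec Carrier n) r} → (∀ y → P y) → Near G x P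
  near-always x p = near-map (λ {y} _ → p y) (near-⊤ {r = 0ℓ} x)

  private
    open-∩* : ∀ {Us Vs : Vec (Pred Carrier u) n} → All IsOpen Us → All IsOpen Vs →
              All IsOpen (zipWith _∩_ Us Vs)
    open-∩* []       []       = []
    open-∩* (o ∷ os) (q ∷ qs) = open-∩ o q ∷ open-∩* os qs

    ∈-∩* : ∀ {x : Vec Carrier n} {Us Vs} → x ∈* Us → x ∈* Vs → x ∈* zipWith _∩_ Us Vs
    ∈-∩* []       []       = []
    ∈-∩* (p ∷ ps) (q ∷ qs) = (p , q) ∷ ∈-∩* ps qs

    ∩*-∈ : ∀ {x : Vec Carrier n} Us Vs → x ∈* zipWith _∩_ Us Vs → x ∈* Us × x ∈* Vs
    ∩*-∈ []       []       []             = [] , []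
    ∩*-∈ (U ∷ Us) (V ∷ Vs) ((p , q) ∷ ps) =
      let a , b = ∩*-∈ Us Vs ps in p ∷ a , q ∷ b

  near-∩ : ∀ {x : Vec Carrier n} {P : Pred (Vec Carrier n) r} {Q : Pred (Vec Carrier n) r′} →
           Near G x P → Near G x Q → Near G x (P ∩ Q)
  near-∩ (near Us o x∈U p) (near Vs q x∈V p′) =
    near (zipWith _∩_ Us Vs) (open-∩* o q) (∈-∩* x∈U x∈V)
    λ y∈ → let a , b = ∩*-∈ Us Vs y∈ in p a , p′ b

  near-∀ : ∀ {x : Vec Carrier n} {P : Fin k → Pred (Vec Carrier n) r} →
           (∀ i → Near G x (P i)) → Near G x (λ y → ∀ i → P i y)
  near-∀ {k = zero}  {x = x} p = near-always x λ _ ()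
  near-∀ {k = suc k} p =
    near-map (λ { (a , b) Fin.zero → a ; (a , b) (Fin.suc i) → b i })
             (near-∩ (p Fin.zero) (near-∀ (p ∘ Fin.suc)))

  near-∘ : ∀ {φ : Vec Carrier n → Vec Carrier k} → Continuous φ → ∀ {x} {P : Pred (Vec Carrier k) r} →
           Near G (φ x) P → Near G x (P ∘ φ)
  near-∘ c {x} (near Us o φx∈ p) = near-map p (c x o φx∈)

  tail-continuous : Continuous {suc n} tail
  tail-continuous (x ∷ xs) {Us} o xs∈ =
    near ((λ _ → ⊤) ∷ Us) (open-⊤ ∷ o) (tt ∷ xs∈) λ { (_ ∷ ys∈) → ys∈ }

  init-continuous : Continuous {suc n} init
  init-continuous {n = zero}  (x ∷ []) []      []        = near-always (x ∷ []) λ { (_ ∷ []) → [] }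
  init-continuous {n = suc n} (x ∷ xs) (o ∷ os) (x∈ ∷ xs∈) =
    let near Vs q xs∈V p = init-continuous xs os xs∈
    in near (_ ∷ Vs) (o ∷ q) (x∈ ∷ xs∈V) λ { (y∈ ∷ ys∈) → y∈ ∷ p ys∈ }

  contract-continuous : (i : Fin n) → Continuous (contract G i)
  contract-continuous Fin.zero (x ∷ y ∷ xs) (o ∷ os) (xy∈ ∷ xs∈) =
    let U , V , Uo , Vo , x∈ , y∈ , p = ∙-continuous o x y xy∈
    in near (U ∷ V ∷ _) (Uo ∷ Vo ∷ os) (x∈ ∷ y∈ ∷ xs∈)
       λ { (x′∈ ∷ y′∈ ∷ xs′∈) → p x′∈ y′∈ ∷ xs′∈ }
  contract-continuous (Fin.suc i) (x ∷ xs) (o ∷ os) (x∈ ∷ xs∈) =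
    let near Vs q xs∈V p = contract-continuous i xs os xs∈
    in near (_ ∷ Vs) (o ∷ q) (x∈ ∷ xs∈V) λ { (y∈ ∷ ys∈) → y∈ ∷ p ys∈ }

  take-continuous : ∀ n → Continuous (take n {k})
  take-continuous zero    xs       []       []         = near-always xs λ _ → []
  take-continuous (suc n) (x ∷ xs) (o ∷ os) (x∈ ∷ xs∈) =
    let near Vs q xs∈V p = take-continuous n xs os xs∈
    in near (_ ∷ Vs) (o ∷ q) (x∈ ∷ xs∈V) λ { (y∈ ∷ ys∈) → y∈ ∷ p ys∈ }

  drop-continuous : ∀ n → Continuous (drop n {k})
  drop-continuous zero    xs       {Us} os xs∈ = near Us os xs∈ id
  drop-continuous (suc n) (x ∷ xs) os xs∈ =
    let near Vs q xs∈V p = drop-continuous n xs os xs∈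
    in near ((λ _ → ⊤) ∷ Vs) (open-⊤ ∷ q) (tt ∷ xs∈V) λ { (_ ∷ ys∈) → p ys∈ }

  private
    _≈*_ : Rel (Vec Carrier n) u
    _≈*_ = Pointwise _≈_

  head-cong : ∀ {x y : Vec Carrier (suc n)} → x ≈* y → head x ≈ head y
  head-cong (e ∷ _) = e

  tail-cong : ∀ {x y : Vec Carrier (suc n)} → x ≈* y → tail x ≈* tail y
  tail-cong (_ ∷ es) = es

  init-cong : ∀ {x y : Vec Carrier (suc n)} → x ≈* y → init x ≈* init y
  init-cong {n = zero}  (_ ∷ [])         = []
  init-cong {n = suc n} {_ ∷ _} {_ ∷ _} (e ∷ es) = e ∷ init-cong es

  contract-cong : ∀ (i : Fin n) {x y} → x ≈* y → contract G i x ≈* contract G i y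
  contract-cong Fin.zero    (e ∷ e′ ∷ es) = ∙-cong e e′ ∷ es
  contract-cong (Fin.suc i) (e ∷ es)      = e ∷ contract-cong i es

  take-cong : ∀ n {x y : Vec Carrier (n ℕ.+ k)} → x ≈* y → take n x ≈* take n y
  take-cong zero    es       = []
  take-cong (suc n) (e ∷ es) = e ∷ take-cong n es

  drop-cong : ∀ n {x y : Vec Carrier (n ℕ.+ k)} → x ≈* y → drop n x ≈* drop n y
  drop-cong zero    es       = es
  drop-cong (suc n) (e ∷ es) = drop-cong n es

module _ (G : TopologicalGroup u) (M : DiscreteModule G m r) where
  private
    module G = TopologicalGroup G
    module M = DiscreteModule M
  open M using (_+_; -_; 0#; _·_)
  open Sum M.commutativeMonoid using (sum; sum-cong-≋)

  -- Continuous for the product topology on Gⁿ and the discrete topology on M.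
  record Cochain (n : ℕ) : Set (lsuc u ⊔ m ⊔ r) where
    field
      fun        : Vec G.Carrier n → M.Carrier
      cong       : ∀ {x y} → Pointwise G._≈_ x y → fun x M.≈ fun y
      continuous : ∀ x → Near G x (λ y → fun y M.≈ fun x)

  open Cochain

  cochainGroup : ℕ → AbelianGroup (lsuc u ⊔ m ⊔ r) (u ⊔ r)
  cochainGroup n = record
    { Carrier = Cochain n
    ; _≈_ = λ a b → ∀ x → fun a x M.≈ fun b x
    ; _∙_ = λ a b → record
      { fun = λ x → fun a x + fun b x
      ; cong = λ e → M.+-cong (cong a e) (cong b e)
      ; continuous = λ x →
          near-map (λ (p , q) → M.+-cong p q) (near-∩ (continuous a x) (continuous b x))
      }
    ; ε = record
      { fun = λ _ → 0#
      ; cong = λ _ → M.refl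
      ; continuous = λ x → near-always x λ _ → M.refl
      }
    ; _⁻¹ = λ a → record
      { fun = λ x → - fun a x
      ; cong = λ e → M.-‿cong (cong a e)
      ; continuous = λ x → near-map M.-‿cong (continuous a x)
      }
    ; isAbelianGroup = record
      { isGroup = record
        { isMonoid = record
          { isSemigroup = record
            { isMagma = record
              { isEquivalence = record
                { refl = λ _ → M.refl
                ; sym = λ e x → M.sym (e x)
                ; trans = λ e e′ x → M.trans (e x) (e′ x)
                }
              ; ∙-cong = λ e e′ x → M.+-cong (e x) (e′ x)
              }
            ; assoc = λ a b c x → M.assoc (fun a x) (fun b x) (fun c x)
            }
          ; identity = (λ a x → M.identityˡ (fun a x)) , (λ a x → M.identityʳ (fun a x))
          }
        ; inverse = (λ a x → M.inverseˡ (fun a x)) , (λ a x → M.inverseʳ (fun a x))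
        ; ⁻¹-cong = λ e x → M.-‿cong (e x)
        }
      ; comm = λ a b x → M.comm (fun a x) (fun b x)
      }
    }

  -- (-1)ᵏ v
  sign : ℕ → M.Carrier → M.Carrier
  sign zero    v = v
  sign (suc k) v = - sign k v

  sign-cong : ∀ k {v w} → v M.≈ w → sign k v M.≈ sign k w
  sign-cong zero    e = e
  sign-cong (suc k) e = M.-‿cong (sign-cong k e)

  -- g₁ · f(g₂,…,gₙ₊₁) + Σᵢ (-1)ⁱ f(g₁,…,gᵢgᵢ₊₁,…,gₙ₊₁) + (-1)ⁿ⁺¹ f(g₁,…,gₙ);
  -- the index i : Fin n starts at 0, hence the shift in the sign.
  coboundaryFun : (Vec G.Carrier n → M.Carrier) → Vec G.Carrier (suc n) → M.Carrier
  coboundaryFun {n = n} f g =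
    head g · f (tail g)
      + sum (λ (i : Fin n) → sign (suc (toℕ i)) (f (contract G i g)))
      + sign (suc n) (f (init g))

  coboundary : Cochain n → Cochain (suc n)
  coboundary {n = n} a = record
    { fun = coboundaryFun (fun a)
    ; cong = λ e → M.+-cong (M.+-cong
        (M.·-cong (head-cong {G = G} e) (cong a (tail-cong {G = G} e)))
        (sum-cong-≋ λ i → sign-cong (suc (toℕ i)) (cong a (contract-cong i e))))
        (sign-cong (suc n) (cong a (init-cong {G = G} e)))
    ; continuous = λ x → near-map
        (λ (((p , q) , s) , t) → M.+-cong (M.+-cong
          (M.trans (M.·-cong G.refl q) p)
          (sum-cong-≋ λ i → sign-cong (suc (toℕ i)) (s i)))
          (sign-cong (suc n) t))
        (near-∩ (near-∩ (near-∩
          (near-action x)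
          (near-∘ tail-continuous (continuous a (tail x))))
          (near-∀ λ i → near-∘ (contract-continuous i) (continuous a (contract G i x))))
          (near-∘ init-continuous (continuous a (init x))))
    }
    where
    near-action : ∀ x → Near G x (λ y → head y · fun a (tail x) M.≈ head x · fun a (tail x))
    near-action (x ∷ xs) =
      let U , Uo , x∈U , p = M.·-continuous x (fun a xs)
          near Us os xs∈ _ = near-⊤ {G = G} {r = 0ℓ} xs
      in near (U ∷ Us) (Uo ∷ os) (x∈U ∷ xs∈) λ { (y∈ ∷ _) → p y∈ }

module _ {G : TopologicalGroup u} {M : DiscreteModule G m r} {N : DiscreteModule G m′ r′}
         (f : ModuleHom M N) where
  private
    module M = DiscreteModule M
    module N = DiscreteModule N
    module f = ModuleHom f
    module ΣM = Sum M.commutativeMonoid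
    module ΣN = Sum N.commutativeMonoid
    open AbelianGroupProperties N.abelianGroup using (identityʳ-unique; inverseʳ-unique)

  0#-homo : f.⟦ M.0# ⟧ N.≈ N.0#
  0#-homo = identityʳ-unique _ _
    (N.trans (N.sym (f.+-homo M.0# M.0#)) (f.⟦⟧-cong (M.identityˡ M.0#)))

  -‿homo : ∀ v → f.⟦ M.- v ⟧ N.≈ N.- f.⟦ v ⟧
  -‿homo v = inverseʳ-unique _ _
    (N.trans (N.sym (f.+-homo v (M.- v))) (N.trans (f.⟦⟧-cong (M.inverseʳ v)) 0#-homo))

  sum-homo : (t : Fin n → M.Carrier) → f.⟦ ΣM.sum t ⟧ N.≈ ΣN.sum (f.⟦_⟧ ∘ t)
  sum-homo {n = zero}  t = 0#-homo
  sum-homo {n = suc n} t =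
    N.trans (f.+-homo _ _) (N.+-cong N.refl (sum-homo (t ∘ Fin.suc)))

  sign-homo : ∀ k v → f.⟦ sign G M k v ⟧ N.≈ sign G N k f.⟦ v ⟧
  sign-homo zero    v = N.refl
  sign-homo (suc k) v = N.trans (-‿homo _) (N.-‿cong (sign-homo k v))

  coboundaryFun-homo : ∀ (a : Vec (TopologicalGroup.Carrier G) n → M.Carrier) g →
    f.⟦ coboundaryFun G M a g ⟧ N.≈ coboundaryFun G N (f.⟦_⟧ ∘ a) g
  coboundaryFun-homo {n = n} a g =
    N.trans (f.+-homo _ _) (N.+-cong
      (N.trans (f.+-homo _ _) (N.+-cong
        (f.·-homo (head g) (a (tail g)))
        (N.trans (sum-homo {n = n} _)
          (ΣN.sum-cong-≋ λ (i : Fin n) → sign-homo (suc (toℕ i)) (a (contract G i g))))))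
      (sign-homo (suc n) (a (init g))))

  mapCochain : Cochain G M n → Cochain G N n
  mapCochain a = record
    { fun = λ x → f.⟦ fun x ⟧
    ; cong = λ e → f.⟦⟧-cong (cong e)
    ; continuous = λ x → near-map f.⟦⟧-cong (continuous x)
    }
    where open Cochain a

module _ (G : TopologicalGroup u) (M : DiscreteModule G m r) where
  private
    module M = DiscreteModule M
    open Cochain
    open Sum M.commutativeMonoid using (sum-cong-≋; ∑-distrib-+)
    open AbelianGroupProperties M.abelianGroup using (⁻¹-∙-comm)
    open CommutativeSemigroupProperties
      (CommutativeMonoid.commutativeSemigroup M.commutativeMonoid)
      using (interchange)

    module C n = AbelianGroup (cochainGroup G M n)

    sign-+ : ∀ k v w → sign G M k (v M.+ w) M.≈ sign G M k v M.+ sign G M k w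
    sign-+ zero    v w = M.refl
    sign-+ (suc k) v w =
      M.trans (M.-‿cong (sign-+ k v w)) (M.sym (⁻¹-∙-comm _ _))

    coboundary-cong : ∀ {a b : Cochain G M n} → C._≈_ n a b →
                      C._≈_ (suc n) (coboundary G M a) (coboundary G M b)
    coboundary-cong {n = n} e x = M.+-cong (M.+-cong
      (M.·-cong (TopologicalGroup.refl G) (e (tail x)))
      (sum-cong-≋ λ (i : Fin n) → sign-cong G M (suc (toℕ i)) (e (contract G i x))))
      (sign-cong G M (suc n) (e (init x)))

    coboundary-+ : ∀ (a b : Cochain G M n) →
      C._≈_ (suc n) (coboundary G M (C._∙_ n a b))
                    (C._∙_ (suc n) (coboundary G M a) (coboundary G M b))
    coboundary-+ {n = n} a b x = M.trans
      (M.+-cong (M.trans (M.+-cong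
          (M.·-distrib (head x) _ _)
          (M.trans (sum-cong-≋ λ (i : Fin n) → sign-+ (suc (toℕ i)) _ _) (∑-distrib-+ {n} _ _)))
          (interchange _ _ _ _))
        (sign-+ (suc n) _ _))
      (interchange _ _ _ _)

    module _ {n : ℕ} where
      private
        module A = AbelianGroup (cochainGroup G M n)
        module B = AbelianGroup (cochainGroup G M (suc n))
        module BP = AbelianGroupProperties (cochainGroup G M (suc n))
        ∂ = coboundary G M {n}

      coboundary-0 : ∂ A.ε B.≈ B.ε
      coboundary-0 = BP.identityʳ-unique (∂ A.ε) (∂ A.ε)
        (B.trans {∂ A.ε B.∙ ∂ A.ε} {∂ (A.ε A.∙ A.ε)} {∂ A.ε}
          (B.sym {∂ (A.ε A.∙ A.ε)} {∂ A.ε B.∙ ∂ A.ε} (coboundary-+ A.ε A.ε))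
          (coboundary-cong {a = A.ε A.∙ A.ε} {b = A.ε} (A.identityˡ A.ε)))

      coboundary-neg : ∀ a → ∂ (a A.⁻¹) B.≈ ∂ a B.⁻¹
      coboundary-neg a = BP.inverseʳ-unique (∂ a) (∂ (a A.⁻¹))
        (B.trans {∂ a B.∙ ∂ (a A.⁻¹)} {∂ (a A.∙ a A.⁻¹)} {B.ε}
          (B.sym {∂ (a A.∙ a A.⁻¹)} {∂ a B.∙ ∂ (a A.⁻¹)} (coboundary-+ a (a A.⁻¹)))
          (B.trans {∂ (a A.∙ a A.⁻¹)} {∂ A.ε} {B.ε}
            (coboundary-cong {a = a A.∙ a A.⁻¹} {b = A.ε} (A.inverseʳ a)) coboundary-0))

  cochainComplex : RawComplex (lsuc u ⊔ m ⊔ r) (u ⊔ r)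
  cochainComplex = record
    { degree = cochainGroup G M
    ; ∂ = coboundary G M
    ; ∂-homo = record
      { isMonoidHomomorphism = record
        { isMagmaHomomorphism = record
          { isRelHomomorphism = record
            { cong = λ {a} {b} e → coboundary-cong {a = a} {b = b} e }
          ; homo = coboundary-+
          }
        ; ε-homo = coboundary-0
        }
      ; ⁻¹-homo = coboundary-neg
      }
    }

module Cohomology (G : TopologicalGroup u) (M : DiscreteModule G m r) where
  open RawComplex (cochainComplex G M) public using (H; _≈H_)

module _ {G : TopologicalGroup u} {M : DiscreteModule G m r} {N : DiscreteModule G m′ r′} where

  mapH : ModuleHom M N → Cohomology.H G M n → Cohomology.H G N n
  mapH f (a , ∂a≈0) = mapCochain f a , λ x →
    N.trans (N.sym (coboundaryFun-homo f (Cochain.fun a) x))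
      (N.trans (ModuleHom.⟦⟧-cong f (∂a≈0 x)) (0#-homo f))
    where module N = DiscreteModule N

-- The cup product is (f ⌣ g)(x₁,…,xₙ₊ₖ) = f(x₁,…,xₙ) g(xₙ₊₁,…,xₙ₊ₖ), the
-- action on the coefficient ring being trivial.
cochainDGRing : TopologicalGroup u → CommutativeRing m r → RawDGRing (lsuc u ⊔ m ⊔ r) (u ⊔ r)
cochainDGRing G R = record
  { complex = cochainComplex G (trivialModule G R.+-abelianGroup)
  ; _⌣_ = λ {n} {k} a b → record
    { fun = λ x → fun a (take n x) R.* fun b (drop n x)
    ; cong = λ e → R.*-cong (cong a (take-cong {G = G} n e)) (cong b (drop-cong {G = G} n e))
    ; continuous = λ x → near-map (λ (p , q) → R.*-cong p q)
        (near-∩ (near-∘ (take-continuous n) (continuous a (take n x)))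
                (near-∘ (drop-continuous n) (continuous b (drop n x))))
    }
  }
  where
  module R = CommutativeRing R
  open Cochain

------------------------------------------------------------------------
-- ℤ/m and the p-adic units

infix 4 _≡_[mod_]
record _≡_[mod_] (a b : ℤ) (m : ℕ) : Set where
  constructor congruent
  field
    divisible : + m ∣ a ℤ.- b

module _ (m : ℕ) where
  private
    by : ∀ {a b} → a ≡ b → + m ∣ a → + m ∣ b
    by ≡.refl p = p

  mod-reflexive : ∀ {a b} → a ≡ b → a ≡ b [mod m ]
  mod-reflexive {a} ≡.refl = congruent (divides 0ℤ (ℤ.+-inverseʳ a))

  mod-refl : ∀ {a} → a ≡ a [mod m ]
  mod-refl = mod-reflexive ≡.refl

  mod-sym : ∀ {a b} → a ≡ b [mod m ] → b ≡ a [mod m ]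
  mod-sym {a} {b} (congruent p) = congruent (by (lem a b) (ℤ∣.∣m⇒∣-m p))
    where
    lem : ∀ a b → ℤ.- (a ℤ.- b) ≡ b ℤ.- a
    lem = solve-∀

  mod-trans : ∀ {a b c} → a ≡ b [mod m ] → b ≡ c [mod m ] → a ≡ c [mod m ]
  mod-trans {a} {b} {c} (congruent p) (congruent q) =
    congruent (by (lem a b c) (ℤ∣.∣m∣n⇒∣m+n p q))
    where
    lem : ∀ a b c → (a ℤ.- b) ℤ.+ (b ℤ.- c) ≡ a ℤ.- c
    lem = solve-∀

  mod-+-cong : ∀ {a b c d} → a ≡ b [mod m ] → c ≡ d [mod m ] → a ℤ.+ c ≡ b ℤ.+ d [mod m ]
  mod-+-cong {a} {b} {c} {d} (congruent p) (congruent q) =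
    congruent (by (lem a b c d) (ℤ∣.∣m∣n⇒∣m+n p q))
    where
    lem : ∀ a b c d → (a ℤ.- b) ℤ.+ (c ℤ.- d) ≡ (a ℤ.+ c) ℤ.- (b ℤ.+ d)
    lem = solve-∀

  mod-*-cong : ∀ {a b c d} → a ≡ b [mod m ] → c ≡ d [mod m ] → a ℤ.* c ≡ b ℤ.* d [mod m ]
  mod-*-cong {a} {b} {c} {d} (congruent p) (congruent q) =
    congruent (by (lem a b c d) (ℤ∣.∣m∣n⇒∣m+n (ℤ∣.∣m⇒∣m*n c p) (ℤ∣.∣n⇒∣m*n b q)))
    where
    lem : ∀ a b c d → (a ℤ.- b) ℤ.* c ℤ.+ b ℤ.* (c ℤ.- d) ≡ a ℤ.* c ℤ.- b ℤ.* d
    lem = solve-∀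

  mod-neg-cong : ∀ {a b} → a ≡ b [mod m ] → ℤ.- a ≡ ℤ.- b [mod m ]
  mod-neg-cong {a} {b} (congruent p) = congruent (by (lem a b) (ℤ∣.∣m⇒∣-m p))
    where
    lem : ∀ a b → ℤ.- (a ℤ.- b) ≡ ℤ.- a ℤ.- ℤ.- b
    lem = solve-∀

  ℤ/ : CommutativeRing 0ℓ 0ℓ
  ℤ/ = record
    { Carrier = ℤ
    ; _≈_ = λ a b → a ≡ b [mod m ]
    ; _+_ = ℤ._+_
    ; _*_ = ℤ._*_
    ; -_ = ℤ.-_
    ; 0# = 0ℤ
    ; 1# = 1ℤ
    ; isCommutativeRing = record
      { isRing = record
        { +-isAbelianGroup = record
          { isGroup = record
            { isMonoid = record
              { isSemigroup = record
                { isMagma = record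
                  { isEquivalence = record { refl = mod-refl ; sym = mod-sym ; trans = mod-trans }
                  ; ∙-cong = mod-+-cong
                  }
                ; assoc = λ a b c → mod-reflexive (ℤ.+-assoc a b c)
                }
              ; identity = (λ a → mod-reflexive (ℤ.+-identityˡ a))
                         , (λ a → mod-reflexive (ℤ.+-identityʳ a))
              }
            ; inverse = (λ a → mod-reflexive (ℤ.+-inverseˡ a))
                      , (λ a → mod-reflexive (ℤ.+-inverseʳ a))
            ; ⁻¹-cong = mod-neg-cong
            }
          ; comm = λ a b → mod-reflexive (ℤ.+-comm a b)
          }
        ; *-cong = mod-*-cong
        ; *-assoc = λ a b c → mod-reflexive (ℤ.*-assoc a b c)
        ; *-identity = (λ a → mod-reflexive (ℤ.*-identityˡ a))
                     , (λ a → mod-reflexive (ℤ.*-identityʳ a))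
        ; distrib = (λ a b c → mod-reflexive (ℤ.*-distribˡ-+ a b c))
                  , (λ a b c → mod-reflexive (ℤ.*-distribʳ-+ a b c))
        }
      ; *-comm = λ a b → mod-reflexive (ℤ.*-comm a b)
      }
    }

module _ (p : ℕ) where

  -- ℤₚ as the inverse limit of the rings ℤ/pⁿ
  record ℤₚ : Set where
    field
      residue  : ℕ → ℤ
      coherent : ∀ n → residue (suc n) ≡ residue n [mod p ^ n ]

  open ℤₚ

  infix 4 _≈ₚ_
  _≈ₚ_ : Rel ℤₚ 0ℓ
  x ≈ₚ y = ∀ n → residue x n ≡ residue y n [mod p ^ n ]

  infixl 7 _*ₚ_
  _*ₚ_ : ℤₚ → ℤₚ → ℤₚ
  x *ₚ y = record
    { residue = λ n → residue x n ℤ.* residue y n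
    ; coherent = λ n → mod-*-cong (p ^ n) (coherent x n) (coherent y n)
    }

  1ₚ : ℤₚ
  1ₚ = record { residue = λ _ → 1ℤ ; coherent = λ n → mod-refl (p ^ n) }

  record ℤₚˣ : Set where
    field
      unit    : ℤₚ
      inv     : ℤₚ
      inverse : unit *ₚ inv ≈ₚ 1ₚ

    open ℤₚ unit public using () renaming (residue to _mod-p^_)

  open ℤₚˣ

  unitGroup : Group 0ℓ 0ℓ
  unitGroup = record
    { Carrier = ℤₚˣ
    ; _≈_ = λ x y → unit x ≈ₚ unit y
    ; _∙_ = λ x y → record
      { unit = unit x *ₚ unit y
      ; inv = inv x *ₚ inv y
      ; inverse = λ n → mod-trans (p ^ n)
          (mod-reflexive (p ^ n) (swap (residue (unit x) n) (residue (unit y) n)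
                                       (residue (inv x) n) (residue (inv y) n)))
          (mod-*-cong (p ^ n) (inverse x n) (inverse y n))
      }
    ; ε = record { unit = 1ₚ ; inv = 1ₚ ; inverse = λ n → mod-refl (p ^ n) }
    ; _⁻¹ = λ x → record
      { unit = inv x ; inv = unit x ; inverse = λ n → inverseˡ x n }
    ; isGroup = record
      { isMonoid = record
        { isSemigroup = record
          { isMagma = record
            { isEquivalence = record
              { refl = λ n → mod-refl (p ^ n)
              ; sym = λ e n → mod-sym (p ^ n) (e n)
              ; trans = λ e e′ n → mod-trans (p ^ n) (e n) (e′ n)
              }
            ; ∙-cong = λ e e′ n → mod-*-cong (p ^ n) (e n) (e′ n)
            }
          ; assoc = λ x y z n → mod-reflexive (p ^ n)
              (ℤ.*-assoc (residue (unit x) n) (residue (unit y) n) (residue (unit z) n))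
          }
        ; identity = (λ x n → mod-reflexive (p ^ n) (ℤ.*-identityˡ (residue (unit x) n)))
                   , (λ x n → mod-reflexive (p ^ n) (ℤ.*-identityʳ (residue (unit x) n)))
        }
      ; inverse = inverseˡ , inverse
      ; ⁻¹-cong = λ {x} {y} e n → inv-cong (p ^ n) (residue (unit x) n) (residue (unit y) n)
                    (residue (inv x) n) (residue (inv y) n) (inverse x n) (inverse y n) (e n)
      }
    }
    where
    swap : ∀ a b c d → (a ℤ.* b) ℤ.* (c ℤ.* d) ≡ (a ℤ.* c) ℤ.* (b ℤ.* d)
    swap = solve-∀

    inverseˡ : ∀ x → inv x *ₚ unit x ≈ₚ 1ₚ
    inverseˡ x n = mod-trans (p ^ n)
      (mod-reflexive (p ^ n) (ℤ.*-comm (residue (inv x) n) (residue (unit x) n))) (inverse x n)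

    inv-cong : ∀ m a b c d → a ℤ.* c ≡ 1ℤ [mod m ] → b ℤ.* d ≡ 1ℤ [mod m ] →
               a ≡ b [mod m ] → c ≡ d [mod m ]
    inv-cong m a b c d ac bd ab = begin
      c                   ≈⟨ mod-reflexive m (ℤ.*-identityʳ c) ⟨
      c ℤ.* 1ℤ            ≈⟨ mod-*-cong m (mod-refl m {c}) bd ⟨
      c ℤ.* (b ℤ.* d)     ≈⟨ mod-*-cong m (mod-refl m {c}) (mod-*-cong m ab (mod-refl m {d})) ⟨
      c ℤ.* (a ℤ.* d)     ≈⟨ mod-reflexive m (assoc′ a c d) ⟩
      (a ℤ.* c) ℤ.* d     ≈⟨ mod-*-cong m ac (mod-refl m {d}) ⟩
      1ℤ ℤ.* d            ≈⟨ mod-reflexive m (ℤ.*-identityˡ d) ⟩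
      d                   ∎
      where
      open SetoidReasoning (CommutativeRing.setoid (ℤ/ m))
      assoc′ : ∀ a c d → c ℤ.* (a ℤ.* d) ≡ (a ℤ.* c) ℤ.* d
      assoc′ = solve-∀

------------------------------------------------------------------------
-- Oriented groups and formal Hilbert 90

record Orientation (p : ℕ) (G : TopologicalGroup u) : Set (lsuc u) where
  open TopologicalGroup G
  open ℤₚˣ
  field
    θ      : Carrier → ℤₚˣ p
    θ-homo : IsGroupHomomorphism rawGroup (Group.rawGroup (unitGroup p)) θ
    -- continuity for the p-adic topology
    θ-continuous : ∀ n g → ∃[ U ] (IsOpen U × g ∈ U ×
                   (∀ {h} → h ∈ U → θ h mod-p^ n ≡ θ g mod-p^ n [mod p ^ n ]))

module _ {p : ℕ} {G : TopologicalGroup u} (or : Orientation p G) where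
  open Orientation or
  open ℤₚˣ
  private module θ = IsGroupHomomorphism θ-homo

  -- ℤ/pⁿ(1)
  twist : ℕ → DiscreteModule G 0ℓ 0ℓ
  twist n = record
    { abelianGroup = CommutativeRing.+-abelianGroup (ℤ/ (p ^ n))
    ; _·_ = λ g v → (θ g mod-p^ n) ℤ.* v
    ; ·-cong = λ e e′ → mod-*-cong (p ^ n) (θ.⟦⟧-cong e n) e′
    ; ·-identity = λ v → mod-trans (p ^ n)
        (mod-*-cong (p ^ n) (θ.ε-homo n) (mod-refl (p ^ n) {v}))
        (mod-reflexive (p ^ n) (ℤ.*-identityˡ v))
    ; ·-assoc = λ g h v → mod-trans (p ^ n)
        (mod-*-cong (p ^ n) (θ.homo g h n) (mod-refl (p ^ n) {v}))
        (mod-reflexive (p ^ n) (ℤ.*-assoc (θ g mod-p^ n) (θ h mod-p^ n) v))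
    ; ·-distrib = λ g v w → mod-reflexive (p ^ n) (ℤ.*-distribˡ-+ (θ g mod-p^ n) v w)
    ; ·-continuous = λ g v →
        let U , Uo , g∈U , c = θ-continuous n g
        in U , Uo , g∈U , λ h∈U → mod-*-cong (p ^ n) (c h∈U) (mod-refl (p ^ n) {v})
    }

  private
    p∣pⁿ : 1 ≤ n → + (p ^ 1) ∣ + (p ^ n)
    p∣pⁿ {suc n} _ = divides (+ (p ^ n)) (≡.trans (≡.cong +_ (lem p (p ^ n))) (ℤ.pos-* (p ^ n) (p ^ 1)))
      where
      lem : ∀ p q → p ℕ.* q ≡ q ℕ.* (p ^ 1)
      lem p q = ≡.trans (ℕ.*-comm p q) (≡.cong (q ℕ.*_) (≡.sym (ℕ.^-identityʳ p)))

    weaken : ∀ {a b} → 1 ≤ n → a ≡ b [mod p ^ n ] → a ≡ b [mod p ^ 1 ]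
    weaken 1≤n (congruent d) = congruent (ℤ∣.∣-trans (p∣pⁿ 1≤n) d)

    residue-mod-p : ∀ (x : ℤₚ p) → 1 ≤ n → ℤₚ.residue x n ≡ ℤₚ.residue x 1 [mod p ^ 1 ]
    residue-mod-p {suc zero}    x _ = mod-refl (p ^ 1)
    residue-mod-p {suc (suc n)} x _ = mod-trans (p ^ 1)
      (weaken {suc n} (ℕ.s≤s ℕ.z≤n) (ℤₚ.coherent x (suc n)))
      (residue-mod-p {suc n} x (ℕ.s≤s ℕ.z≤n))

  reduction : 1 ≤ n → ModuleHom (twist n) (twist 1)
  reduction {n} 1≤n = record
    { ⟦_⟧ = id
    ; ⟦⟧-cong = weaken {n} 1≤n
    ; +-homo = λ v w → mod-refl (p ^ 1)
    ; ·-homo = λ g v → mod-*-cong (p ^ 1)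
        (residue-mod-p (unit (θ g)) 1≤n) (mod-refl (p ^ 1) {v})
    }

  FormalHilbert90 : Set (lsuc u)
  FormalHilbert90 = (K : OpenSubgroup G) (n : ℕ) (1≤n : 1 ≤ n) →
    let open Cohomology (OpenSubgroup.topologicalGroup K) in
    Surjective (_≈H_ (restrict K (twist n)) {1}) (_≈H_ (restrict K (twist 1)) {1})
               (mapH (restrictHom K (reduction 1≤n)))

{-# OPTIONS --safe #-}
module Submission where

-- Write a, b, c for χ₁, χ₂, χ₃, and let N = ker a, C = ker c.  Restricted to N,
-- the entries a₁₃ and a₃₅ of a defining system are homomorphisms α and δ, and it
-- suffices to find ρ ∈ H¹(G) with (α + ρ) ∪ δ = 0 on N, that is, with
-- α + ρ = cor ζ for some ζ ∈ H¹(D), D = ker δ: then a₁₃ + ρ extends to a defining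
-- system whose value is an explicit coboundary.
--
-- The entry a₃₅ gives an action of G on a square, in which D fixes a vertex and
-- Y = ker (a₃₅|C) fixes an edge; N and C are the stabilisers of a pair of opposite
-- vertices and of a pair of opposite edges.  As the product is defined, there is
-- ω ∈ H¹(Y) whose corestriction to C is b, which is also the corestriction of α
-- to G.  By formal Hilbert 90 modulo 4, α and ω lift to ℤ/4(1)-cocycles; after ω
-- is changed by an element of H¹(C), both lifts have the same corestriction ν.
-- Attach to each vertex the lift of α at it, plus the lifts of ω at its two edges,
-- minus ν.  This cocycle on D has corestriction 2α on N, and modulo 2 it is the
-- restriction of a character ρ of G.  Subtracting a lift of ρ leaves 2ζ, and
-- cor ζ = α + ρ.
--
-- Subgroups are replaced by finite G-sets and their cohomology by that of the
-- action groupoids, so that restriction and corestriction are explicit and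
-- degenerate cases (such as a = 0) need no separate treatment.

open import Defs
open import Axiom.ExcludedMiddle using (ExcludedMiddle)
open import Algebra.Bundles using (AbelianGroup)
open import Algebra.Morphism.Structures using (IsGroupHomomorphism)
open import Data.Bool.Base using (Bool; true; false; _∧_; _xor_; not; if_then_else_)
open import Data.Bool.Properties using (_≟_; xor-identityʳ; xor-same)
open import Data.Fin.Base as Fin using (Fin)
open import Data.Integer.Base as ℤ using (ℤ; +_; 0ℤ; 1ℤ)
open import Data.Integer.DivMod using (_%ℕ_; _/ℕ_; n%ℕd<d; a≡a%ℕn+[a/ℕn]*n)
open import Data.Integer.Divisibility.Signed as ℤ∣ using (divides; _∣?_)
open import Data.Integer.Tactic.RingSolver using (solve-∀)
open import Data.List.Base using (List; []; _∷_; [_]; _++_; map)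
open import Data.List.Membership.Propositional using (_∈_)
open import Data.List.Membership.Propositional.Properties using (∈-map⁺; ∈-++⁺ˡ; ∈-++⁺ʳ)
open import Data.List.Relation.Unary.Any using (here; there)
open import Data.Nat.Base as ℕ using (ℕ; zero; suc; z≤n; s≤s)
open import Data.Product.Base using (∃; ∃-syntax; Σ-syntax; _×_; _,_; proj₁; proj₂)
open import Data.Product.Properties using (≡-dec)
open import Data.Unit.Base using (⊤; tt)
open import Data.Vec.Base using ([]; _∷_; lookup)
open import Data.Vec.Relation.Binary.Pointwise.Inductive using ([]; _∷_)
open import Data.Vec.Relation.Unary.All using ([]; _∷_)
open import Function.Base using (_∘_; id)
open import Function.Bundles using (mk⇔)
open import Level using (Level; Lift; lift; lower) renaming (suc to lsuc)
open import Relation.Binary.Definitions using (DecidableEquality)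
open import Relation.Binary.PropositionalEquality using (_≡_; refl; sym; trans; cong; cong₂; module ≡-Reasoning)
open import Relation.Nullary.Decidable using (does-⇔; dec-true)
open import Relation.Nullary.Decidable.Core using (Dec; yes; does; True; toWitness; map′; _×-dec_; _→-dec_)
open import Relation.Nullary.Negation.Core using (¬_; contradiction)
open import Relation.Unary using (Pred)

import Algebra.Properties.Group as GroupProperties
import Data.Nat.Properties as ℕ

-- Truth tables and arithmetic modulo 4

∀Bool? : ∀ {ℓ} {P : Bool → Set ℓ} → (∀ x → Dec (P x)) → Dec (∀ x → P x)
∀Bool? P? = map′ (λ { (p , q) false → p ; (p , q) true → q })
                 (λ p → p false , p true) (P? false ×-dec P? true)

Predⁿ : ℕ → Set₁
Predⁿ zero    = Set
Predⁿ (suc n) = Bool → Predⁿ n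

∀ⁿ ∀ⁿDec : ∀ n → Predⁿ n → Set
∀ⁿ zero    P = P
∀ⁿ (suc n) P = ∀ x → ∀ⁿ n (P x)
∀ⁿDec zero    P = Dec P
∀ⁿDec (suc n) P = ∀ x → ∀ⁿDec n (P x)

∀ⁿ? : ∀ n {P : Predⁿ n} → ∀ⁿDec n P → Dec (∀ⁿ n P)
∀ⁿ? zero    P? = P?
∀ⁿ? (suc n) P? = ∀Bool? λ x → ∀ⁿ? n (P? x)

-- The implicit `True P?` is solved by evaluation, so each `table` below is a proof by exhausting
-- all values in `Bool` or `ℤ₄`.
decided : ∀ {ℓ} {P : Set ℓ} (P? : Dec P) {_ : True P?} → P
decided P? {t} = toWitness t

-- The pair (l , h) stands for the residue l + 2h modulo 4.
ℤ₄ : Set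
ℤ₄ = Bool × Bool

lo hi : ℤ₄ → Bool
lo = proj₁
hi = proj₂

infixl 6 _⊕_
_⊕_ : ℤ₄ → ℤ₄ → ℤ₄
(l , h) ⊕ (l′ , h′) = l xor l′ , (h xor h′) xor (l ∧ l′)

⊖_ : ℤ₄ → ℤ₄
⊖ (l , h) = l , l xor h

-- multiplication by (-1)ᵏ
twisted : Bool → ℤ₄ → ℤ₄
twisted k (l , h) = l , (k ∧ l) xor h

double : ℤ₄ → ℤ₄
double (l , h) = false , l

infix 4 _≟₄_
_≟₄_ : DecidableEquality ℤ₄
_≟₄_ = ≡-dec _≟_ _≟_

∀ℤ₄? : ∀ {ℓ} {P : ℤ₄ → Set ℓ} → (∀ x → Dec (P x)) → Dec (∀ x → P x)
∀ℤ₄? P? = map′ (λ p x → p (lo x) (hi x)) (λ p l h → p (l , h))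
               (∀Bool? λ l → ∀Bool? λ h → P? (l , h))

-- Residues of integers

bit : Bool → ℤ
bit false = 0ℤ
bit true  = 1ℤ

⟦_⟧₄ : ℤ₄ → ℤ
⟦ l , h ⟧₄ = bit l ℤ.+ + 2 ℤ.* bit h

_≡?_[mod_] : ∀ a b m → Dec (a ≡ b [mod m ])
a ≡? b [mod m ] = map′ congruent _≡_[mod_].divisible (+ m ∣? a ℤ.- b)

bits : ℕ → ℤ₄
bits 0 = false , false
bits 1 = true , false
bits 2 = false , true
bits _ = true , true

residue₄ : ℤ → ℤ₄
residue₄ z = bits (z %ℕ 4)

⟦residue₄⟧ : ∀ z → z ≡ ⟦ residue₄ z ⟧₄ [mod 4 ]
⟦residue₄⟧ z = congruent (divides (z /ℕ 4) (begin
  z ℤ.- ⟦ residue₄ z ⟧₄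
    ≡⟨ cong₂ ℤ._-_ (a≡a%ℕn+[a/ℕn]*n z 4) (⟦bits⟧ (z %ℕ 4) (n%ℕd<d z 4)) ⟩
  (+ (z %ℕ 4) ℤ.+ (z /ℕ 4) ℤ.* + 4) ℤ.- + (z %ℕ 4)
    ≡⟨ lemma (+ (z %ℕ 4)) _ ⟩
  (z /ℕ 4) ℤ.* + 4 ∎))
  where
  open ≡-Reasoning
  lemma : ∀ a b → (a ℤ.+ b) ℤ.- a ≡ b
  lemma = solve-∀
  ⟦bits⟧ : ∀ n → n ℕ.< 4 → ⟦ bits n ⟧₄ ≡ + n
  ⟦bits⟧ 0 _ = refl
  ⟦bits⟧ 1 _ = refl
  ⟦bits⟧ 2 _ = refl
  ⟦bits⟧ 3 _ = refl
  ⟦bits⟧ (suc (suc (suc (suc _)))) (s≤s (s≤s (s≤s (s≤s ()))))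

⟦⟧₄-injective : ∀ x y → ⟦ x ⟧₄ ≡ ⟦ y ⟧₄ [mod 4 ] → x ≡ y
⟦⟧₄-injective = decided (∀ℤ₄? λ x → ∀ℤ₄? λ y → (_ ≡? _ [mod _ ]) →-dec (x ≟₄ y))

residue₄-unique : ∀ {z x} → z ≡ ⟦ x ⟧₄ [mod 4 ] → residue₄ z ≡ x
residue₄-unique {z} p = ⟦⟧₄-injective _ _ (mod-trans 4 (mod-sym 4 (⟦residue₄⟧ z)) p)

residue₄-cong : ∀ {y z} → y ≡ z [mod 4 ] → residue₄ y ≡ residue₄ z
residue₄-cong {y} {z} p = residue₄-unique (mod-trans 4 p (⟦residue₄⟧ z))

infixl 7 _⊗_
_⊗_ : ℤ₄ → ℤ₄ → ℤ₄
(l , h) ⊗ (l′ , h′) = l ∧ l′ , (l ∧ h′) xor (h ∧ l′)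

residue₄-+ : ∀ y z → residue₄ (y ℤ.+ z) ≡ residue₄ y ⊕ residue₄ z
residue₄-+ y z = residue₄-unique (mod-trans 4 (mod-+-cong 4 (⟦residue₄⟧ y) (⟦residue₄⟧ z))
                                              (⟦⟧₄-+ (residue₄ y) (residue₄ z)))
  where
  ⟦⟧₄-+ : ∀ x y → ⟦ x ⟧₄ ℤ.+ ⟦ y ⟧₄ ≡ ⟦ x ⊕ y ⟧₄ [mod 4 ]
  ⟦⟧₄-+ = decided (∀ℤ₄? λ _ → ∀ℤ₄? λ _ → _ ≡? _ [mod _ ])

residue₄-* : ∀ y z → residue₄ (y ℤ.* z) ≡ residue₄ y ⊗ residue₄ z
residue₄-* y z = residue₄-unique (mod-trans 4 (mod-*-cong 4 (⟦residue₄⟧ y) (⟦residue₄⟧ z))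
                                              (⟦⟧₄-* (residue₄ y) (residue₄ z)))
  where
  ⟦⟧₄-* : ∀ x y → ⟦ x ⟧₄ ℤ.* ⟦ y ⟧₄ ≡ ⟦ x ⊗ y ⟧₄ [mod 4 ]
  ⟦⟧₄-* = decided (∀ℤ₄? λ _ → ∀ℤ₄? λ _ → _ ≡? _ [mod _ ])

residue₄-neg : ∀ z → residue₄ (ℤ.- z) ≡ ⊖ residue₄ z
residue₄-neg z = residue₄-unique (mod-trans 4 (mod-neg-cong 4 (⟦residue₄⟧ z)) (⟦⟧₄-neg (residue₄ z)))
  where
  ⟦⟧₄-neg : ∀ x → ℤ.- ⟦ x ⟧₄ ≡ ⟦ ⊖ x ⟧₄ [mod 4 ]
  ⟦⟧₄-neg = decided (∀ℤ₄? λ _ → _ ≡? _ [mod _ ])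

parity : ℤ → Bool
parity = lo ∘ residue₄

parity-+ : ∀ y z → parity (y ℤ.+ z) ≡ parity y xor parity z
parity-+ y z = cong lo (residue₄-+ y z)

parity-* : ∀ y z → parity (y ℤ.* z) ≡ parity y ∧ parity z
parity-* y z = cong lo (residue₄-* y z)

parity-neg : ∀ z → parity (ℤ.- z) ≡ parity z
parity-neg z = cong lo (residue₄-neg z)

parity-bit : ∀ x → parity (bit x) ≡ x
parity-bit = decided (∀ⁿ? 1 λ _ → _ ≟ _)

≡-parity : ∀ z → z ≡ bit (parity z) [mod 2 ]
≡-parity z = mod-trans 2 (weaken (⟦residue₄⟧ z)) (table (residue₄ z))
  where
  weaken : ∀ {a b} → a ≡ b [mod 4 ] → a ≡ b [mod 2 ]
  weaken (congruent p) = congruent (ℤ∣.∣-trans (divides (+ 2) refl) p)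
  table : ∀ x → ⟦ x ⟧₄ ≡ bit (lo x) [mod 2 ]
  table = decided (∀ℤ₄? λ _ → _ ≡? _ [mod _ ])

parity-cong : ∀ {y z} → y ≡ z [mod 2 ] → parity y ≡ parity z
parity-cong {y} {z} p = injective _ _ (mod-trans 2 (mod-sym 2 (≡-parity y)) (mod-trans 2 p (≡-parity z)))
  where
  injective : ∀ x y → bit x ≡ bit y [mod 2 ] → x ≡ y
  injective = decided (∀ⁿ? 2 λ x y → (_ ≡? _ [mod _ ]) →-dec (x ≟ y))

parity-reflects : ∀ {y z} → parity y ≡ parity z → y ≡ z [mod 2 ]
parity-reflects {y} {z} p = mod-trans 2 (≡-parity y)
  (mod-trans 2 (mod-reflexive 2 (cong bit p)) (mod-sym 2 (≡-parity z)))

-- Selection from a finite list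

firstWith : ∀ {A : Set} → (A → Bool) → A → List A → A
firstWith P d []       = d
firstWith P d (x ∷ xs) = if P x then x else firstWith P d xs

firstWith-holds : ∀ {A : Set} {P : A → Bool} {d v} xs → v ∈ xs → P v ≡ true →
                  P (firstWith P d xs) ≡ true
firstWith-holds {P = P} (x ∷ xs) v∈ Pv with P x in eq
... | true = eq
firstWith-holds (x ∷ xs) (here refl) Pv | false with () ← trans (sym eq) Pv
firstWith-holds (x ∷ xs) (there v∈)  Pv | false = firstWith-holds xs v∈ Pv

-- The witness `v` keeps the search from reaching the end of the list, so the two defaults may
-- differ. This is what makes an orbit representative depend on the orbit alone.
firstWith-cong : ∀ {A : Set} {P Q : A → Bool} {d d′ v} xs → (∀ w → P w ≡ Q w) → v ∈ xs → P v ≡ true →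
                 firstWith P d xs ≡ firstWith Q d′ xs
firstWith-cong {P = P} {Q} (x ∷ xs) P≗Q v∈ Pv with P x in eq | Q x | P≗Q x
... | true  | .true  | refl = refl
firstWith-cong (x ∷ xs) P≗Q (here refl) Pv | false | .false | refl with () ← trans (sym eq) Pv
firstWith-cong (x ∷ xs) P≗Q (there v∈)  Pv | false | .false | refl = firstWith-cong xs P≗Q v∈ Pv

from-does : ∀ {ℓ} {A : Set ℓ} (a? : Dec A) → does a? ≡ true → A
from-does (yes a) _ = a

module _ {u : Level} (G : TopologicalGroup u) where
  open TopologicalGroup G using
    ( Carrier; _≈_; _∙_; _⁻¹; ε; group; assoc; identityˡ; inverseˡ; inverseʳ; ∙-congˡ; ∙-congʳ
    ; IsOpen; open-∩; open-⋃; open-⊤; open-resp-≈; open-resp-≐; ∙-continuous )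
    renaming (refl to ≈-refl; sym to ≈-sym; trans to ≈-trans)

  -- Locally constant functions and finite G-sets

  private
    variable
      S T W : Set

  LocallyConstant : (Carrier → S) → Set (lsuc u)
  LocallyConstant f =
    ∀ x → Σ[ U ∈ Pred Carrier u ] IsOpen U × U x × (∀ {y} → U y → f y ≡ f x)

  -- Open sets respect `≈`, hence so does a function that is constant on them; this is why `Cocycle`
  -- and `GSet` carry no congruence field.
  lc-resp : {f : Carrier → S} → LocallyConstant f → ∀ {x y} → x ≈ y → f x ≡ f y
  lc-resp lf {x} x≈y =
    let U , Uo , x∈U , c = lf x in sym (c (open-resp-≈ Uo x≈y x∈U))

  lc-const : (c : S) → LocallyConstant (λ _ → c)
  lc-const c x = _ , open-⊤ , _ , λ _ → refl

  lc-bind : {f : Carrier → S} {k : S → Carrier → T} →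
            LocallyConstant f → (∀ w → LocallyConstant (k w)) → LocallyConstant (λ g → k (f g) g)
  lc-bind {f = f} {k} lf lk x =
    let U , Uo , x∈U , c = lf x
        V , Vo , x∈V , d = lk (f x) x
    in _ , open-∩ Uo Vo , (x∈U , x∈V) ,
       λ {y} (y∈U , y∈V) → trans (cong (λ w → k w y) (c y∈U)) (d y∈V)

  lc-map : (k : S → T) {f : Carrier → S} → LocallyConstant f → LocallyConstant (λ g → k (f g))
  lc-map k lf = lc-bind lf (λ w → lc-const (k w))

  lc-map₂ : (k : S → T → W) {f : Carrier → S} {f′ : Carrier → T} →
            LocallyConstant f → LocallyConstant f′ → LocallyConstant (λ g → k (f g) (f′ g))
  lc-map₂ k lf lf′ = lc-bind lf (λ w → lc-map (k w) lf′)

  lc-translate : {f : Carrier → S} → LocallyConstant f → ∀ s t → LocallyConstant (λ g → f (s ∙ g ∙ t))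
  lc-translate lf s t x =
    let W , Wo , x∈W , c = lf (s ∙ x ∙ t)
        U , V , Uo , _ , sx∈U , t∈V , UV⊆W = ∙-continuous Wo (s ∙ x) t x∈W
        U′ , V′ , _ , V′o , s∈U′ , x∈V′ , U′V′⊆U = ∙-continuous Uo s x sx∈U
    in V′ , V′o , x∈V′ , λ y∈V′ → c (UV⊆W (U′V′⊆U s∈U′ y∈V′) t∈V)

  lc-open : {P : Carrier → Bool} → LocallyConstant P → IsOpen (λ g → Lift u (P g ≡ true))
  lc-open {P} lP = open-resp-≐
    ( (λ ((x , Px) , y∈U) → lift (trans (proj₂ (proj₂ (proj₂ (lP x))) y∈U) (lower Px)))
    , (λ {x} Px → (x , Px) , proj₁ (proj₂ (proj₂ (lP x)))))
    (open-⋃ {I = Σ[ x ∈ Carrier ] Lift u (P x ≡ true)} {U = λ (x , _) → proj₁ (lP x)}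
            (λ (x , _) → proj₁ (proj₂ (lP x))))

  -- Finiteness is a listing of the points, possibly with repetitions, through which one can search;
  -- `▹-lc` makes the stabilisers open.
  record GSet : Set (lsuc u) where
    infixr 7 _▹_
    field
      Point    : Set
      points   : List Point
      complete : ∀ v → v ∈ points
      _▹_      : Carrier → Point → Point
      ε-▹      : ∀ v → ε ▹ v ≡ v
      ∙-▹      : ∀ g h v → (g ∙ h) ▹ v ≡ g ▹ h ▹ v
      ▹-lc     : ∀ v → LocallyConstant (_▹ v)

  open GSet using (Point)

  -- Cocycles on the action groupoid of X; for X = G/H these are, up to
  -- coboundaries, the homomorphisms H → ℤ/2.
  record Cocycle (X : GSet) : Set (lsuc u) where
    open GSet X using (_▹_)
    field
      fun : Carrier → Point X → Bool
      lc  : ∀ v → LocallyConstant (λ g → fun g v)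
      ∙-homo : ∀ g h v → fun (g ∙ h) v ≡ fun g (h ▹ v) xor fun h v

    ε-homo : ∀ v → fun ε v ≡ false
    ε-homo v = cancel (fun ε v) (begin
      fun ε v                  ≡⟨ lc-resp (lc v) (identityˡ ε) ⟨
      fun (ε ∙ ε) v            ≡⟨ ∙-homo ε ε v ⟩
      fun ε (ε ▹ v) xor fun ε v ≡⟨ cong (λ w → fun ε w xor fun ε v) (GSet.ε-▹ X v) ⟩
      fun ε v xor fun ε v      ∎)
      where
      open ≡-Reasoning
      cancel : ∀ x → x ≡ x xor x → x ≡ false
      cancel = decided (∀Bool? λ x → (x ≟ x xor x) →-dec (x ≟ false))

  point : GSet
  point = record
    { Point = ⊤ ; points = [ tt ] ; complete = λ _ → here refl ; _▹_ = λ _ v → v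
    ; ε-▹ = λ _ → refl ; ∙-▹ = λ _ _ _ → refl ; ▹-lc = lc-const }

  -- the double cover of X defined by χ
  infixl 5 _⋉_
  _⋉_ : (X : GSet) → Cocycle X → GSet
  X ⋉ χ = record
    { Point = Point X × Bool
    ; points = map (_, false) X.points ++ map (_, true) X.points
    ; complete = λ where
        (v , false) → ∈-++⁺ˡ (∈-map⁺ (_, false) (X.complete v))
        (v , true)  → ∈-++⁺ʳ (map (_, false) X.points) (∈-map⁺ (_, true) (X.complete v))
    ; _▹_ = λ g (v , j) → g X.▹ v , j xor χ.fun g v
    ; ε-▹ = λ (v , j) → cong₂ _,_ (X.ε-▹ v) (trans (cong (j xor_) (χ.ε-homo v)) (xor-identityʳ j))
    ; ∙-▹ = λ g h (v , j) → cong₂ _,_ (X.∙-▹ g h v)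
        (trans (cong (j xor_) (χ.∙-homo g h v)) (shuffle j (χ.fun g (h X.▹ v)) (χ.fun h v)))
    ; ▹-lc = λ (v , j) → lc-map₂ (λ w x → w , j xor x) (X.▹-lc v) (χ.lc v)
    }
    where
    module X = GSet X
    module χ = Cocycle χ
    shuffle : ∀ j x y → j xor (x xor y) ≡ (j xor y) xor x
    shuffle = decided (∀Bool? λ j → ∀Bool? λ x → ∀Bool? λ y → j xor (x xor y) ≟ (j xor y) xor x)

  module _ (κ : Carrier → Bool) where

    -- Once `κ` is read off from θ modulo 4, these are the cocycles of the action groupoid with
    -- values in ℤ/4(1).
    record Cocycle₄ (X : GSet) : Set (lsuc u) where
      open GSet X using (_▹_)
      field
        fun : Carrier → Point X → ℤ₄
        lc  : ∀ v → LocallyConstant (λ g → fun g v)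
        ∙-homo : ∀ g h v → fun (g ∙ h) v ≡ fun g (h ▹ v) ⊕ twisted (κ g) (fun h v)

    -- The lift has to reduce to `χ` itself, not merely to a cohomologous cocycle, so that later
    -- identities can be checked pointwise.
    Hilbert90 : GSet → Set (lsuc u)
    Hilbert90 X = (χ : Cocycle X) →
      Σ[ F ∈ Cocycle₄ X ] (∀ g v → lo (Cocycle₄.fun F g v) ≡ Cocycle.fun χ g v)

  -- Operations on cocycles modulo 4

  module _ {κ : Carrier → Bool} where
    open Cocycle₄

    infixl 6 _⊞_
    _⊞_ : ∀ {X} → Cocycle₄ κ X → Cocycle₄ κ X → Cocycle₄ κ X
    _⊞_ {X} E F = record
      { fun = λ g v → fun E g v ⊕ fun F g v
      ; lc = λ v → lc-map₂ _⊕_ (lc E v) (lc F v)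
      ; ∙-homo = λ g h v → trans (cong₂ _⊕_ (∙-homo E g h v) (∙-homo F g h v))
          (interchange (κ g) (fun E g (h ▹ v)) (fun E h v) (fun F g (h ▹ v)) (fun F h v))
      }
      where
      open GSet X using (_▹_)
      interchange : ∀ k x y z w → (x ⊕ twisted k y) ⊕ (z ⊕ twisted k w) ≡ (x ⊕ z) ⊕ twisted k (y ⊕ w)
      interchange = decided (∀Bool? λ k → ∀ℤ₄? λ x → ∀ℤ₄? λ y → ∀ℤ₄? λ z → ∀ℤ₄? λ w →
        (x ⊕ twisted k y) ⊕ (z ⊕ twisted k w) ≟₄ (x ⊕ z) ⊕ twisted k (y ⊕ w))

    ⊟_ : ∀ {X} → Cocycle₄ κ X → Cocycle₄ κ X
    ⊟_ {X} F = record
      { fun = λ g v → ⊖ fun F g v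
      ; lc = λ v → lc-map ⊖_ (lc F v)
      ; ∙-homo = λ g h v → trans (cong ⊖_ (∙-homo F g h v)) (distrib (κ g) (fun F g (h ▹ v)) (fun F h v))
      }
      where
      open GSet X using (_▹_)
      distrib : ∀ k x y → ⊖ (x ⊕ twisted k y) ≡ ⊖ x ⊕ twisted k (⊖ y)
      distrib = decided (∀Bool? λ k → ∀ℤ₄? λ x → ∀ℤ₄? λ y →
        ⊖ (x ⊕ twisted k y) ≟₄ ⊖ x ⊕ twisted k (⊖ y))

    pullback : ∀ {X Y} (π : Point X → Point Y) →
               (∀ g v → π (GSet._▹_ X g v) ≡ GSet._▹_ Y g (π v)) → Cocycle₄ κ Y → Cocycle₄ κ X
    pullback π equivariant F = record
      { fun = λ g v → fun F g (π v)
      ; lc = λ v → lc F (π v)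
      ; ∙-homo = λ g h v → trans (∙-homo F g h (π v))
          (cong (λ w → fun F g w ⊕ twisted (κ g) (fun F h (π v))) (sym (equivariant h v)))
      }

    -- For a double cover, corestriction is the sum over the two sheets. A group element either
    -- preserves or exchanges the sheets above a point, and the sum is the same in both cases.
    corestriction : ∀ {X} {χ : Cocycle X} → Cocycle₄ κ (X ⋉ χ) → Cocycle₄ κ X
    corestriction {X} {χ} F = record
      { fun = λ g v → fun F g (v , false) ⊕ fun F g (v , true)
      ; lc = λ v → lc-map₂ _⊕_ (lc F (v , false)) (lc F (v , true))
      ; ∙-homo = λ g h v → trans (cong₂ _⊕_ (∙-homo F g h (v , false)) (∙-homo F g h (v , true)))
          (interchange (κ g) (Cocycle.fun χ h v) (λ j → fun F g (h ▹ v , j)) (fun F h (v , false)) (fun F h (v , true)))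
      }
      where
      open GSet X using (_▹_)
      swap : ∀ k x x′ y z →
        (x ⊕ twisted k y) ⊕ (x′ ⊕ twisted k z) ≡ (x ⊕ x′) ⊕ twisted k (y ⊕ z) ×
        (x′ ⊕ twisted k y) ⊕ (x ⊕ twisted k z) ≡ (x ⊕ x′) ⊕ twisted k (y ⊕ z)
      swap = decided (∀Bool? λ k → ∀ℤ₄? λ x → ∀ℤ₄? λ x′ → ∀ℤ₄? λ y → ∀ℤ₄? λ z →
        ((x ⊕ twisted k y) ⊕ (x′ ⊕ twisted k z) ≟₄ (x ⊕ x′) ⊕ twisted k (y ⊕ z)) ×-dec
        ((x′ ⊕ twisted k y) ⊕ (x ⊕ twisted k z) ≟₄ (x ⊕ x′) ⊕ twisted k (y ⊕ z)))
      -- Here `j` is the value of `χ` at `h` and `v`, which tells whether `h` exchanges the sheets.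
      interchange : ∀ k j (x : Bool → ℤ₄) y z →
        (x j ⊕ twisted k y) ⊕ (x (true xor j) ⊕ twisted k z) ≡ (x false ⊕ x true) ⊕ twisted k (y ⊕ z)
      interchange k false x y z = proj₁ (swap k (x false) (x true) y z)
      interchange k true  x y z = proj₂ (swap k (x false) (x true) y z)

    reduction₂ : ∀ {X} → Cocycle₄ κ X → Cocycle X
    reduction₂ F = record
      { fun = λ g v → lo (fun F g v)
      ; lc = λ v → lc-map lo (lc F v)
      ; ∙-homo = λ g h v → cong lo (∙-homo F g h v)
      }

    -- The even residues form a copy of ℤ/2 on which the sign acts trivially, and adding them
    -- produces no carry.
    half : ∀ {X} (F : Cocycle₄ κ X) → (∀ g v → lo (fun F g v) ≡ false) → Cocycle X
    half {X} F even = record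
      { fun = λ g v → hi (fun F g v)
      ; lc = λ v → lc-map hi (lc F v)
      ; ∙-homo = λ g h v → trans (cong hi (∙-homo F g h v))
          (carry (κ g) (fun F g (h ▹ v)) (fun F h v) (even g (h ▹ v)) (even h v))
      }
      where
      open GSet X using (_▹_)
      carry : ∀ k x y → lo x ≡ false → lo y ≡ false → hi (x ⊕ twisted k y) ≡ hi x xor hi y
      carry = decided (∀Bool? λ k → ∀ℤ₄? λ x → ∀ℤ₄? λ y →
        (lo x ≟ false) →-dec (lo y ≟ false) →-dec (hi (x ⊕ twisted k y) ≟ hi x xor hi y))

  -- Correcting a defining system

  LC : (Carrier → Bool) → Set (lsuc u)
  LC = LocallyConstant

  infix 4 _∂≗_
  -- The equation ∂f = r modulo 2 with trivial action, solved for `f (g ∙ h)` so that it can serve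
  -- as a rewrite rule.
  _∂≗_ : (Carrier → Bool) → (Carrier → Carrier → Bool) → Set u
  f ∂≗ r = ∀ g h → f (g ∙ h) ≡ (f g xor f h) xor r g h

  infix 6 _∪_
  _∪_ : (Carrier → Bool) → (Carrier → Bool) → Carrier → Carrier → Bool
  (e ∪ f) g h = e g ∧ f h

  infixr 5 _⊹_
  _⊹_ : (Carrier → Carrier → Bool) → (Carrier → Carrier → Bool) → Carrier → Carrier → Bool
  (r ⊹ s) g h = r g h xor s g h

  character : ∀ {f} → LC f → f ∂≗ (λ _ _ → false) → (X : GSet) → Cocycle X
  character {f} lc-f ∂f X = record
    { fun = λ g _ → f g
    ; lc = λ _ → lc-f
    ; ∙-homo = λ g h _ → trans (∂f g h) (xor-identityʳ _)
    }

  -- The functions are the entries of a defining system modulo 2, where `a` stands for both the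
  -- (1,2) and the (4,5) entry.
  module Correction {a b c d₁₃ d₂₄ d₃₅ d₁₄ d₂₅ : Carrier → Bool}
    (lc-a : LC a) (lc-b : LC b) (lc-c : LC c) (lc₁₃ : LC d₁₃) (lc₂₄ : LC d₂₄)
    (lc₃₅ : LC d₃₅) (lc₁₄ : LC d₁₄) (lc₂₅ : LC d₂₅)
    (∂a : a ∂≗ λ _ _ → false) (∂b : b ∂≗ λ _ _ → false) (∂c : c ∂≗ λ _ _ → false)
    (∂₁₃ : d₁₃ ∂≗ a ∪ b) (∂₂₄ : d₂₄ ∂≗ b ∪ c) (∂₃₅ : d₃₅ ∂≗ c ∪ a)
    (∂₁₄ : d₁₄ ∂≗ a ∪ d₂₄ ⊹ d₁₃ ∪ c) (∂₂₅ : d₂₅ ∂≗ b ∪ d₃₅ ⊹ d₂₄ ∪ a)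
    where

    infixl 5 _+lc_
    infixl 6 _*lc_
    _+lc_ : ∀ {f f′} → LC f → LC f′ → LC (λ g → f g xor f′ g)
    _+lc_ = lc-map₂ _xor_
    _*lc_ : ∀ {f f′} → LC f → LC f′ → LC (λ g → f g ∧ f′ g)
    _*lc_ = lc-map₂ _∧_

    -- The square and the classes attached to it

    χa χc : Cocycle point
    χa = character lc-a ∂a point
    χc = character lc-c ∂c point

    N C : GSet
    N = point ⋉ χa
    C = point ⋉ χc

    -- Since ∂ d₁₃ = a ∪ b, the cochain d₁₃ + ab has coboundary b ∪ a; likewise
    -- d₃₅ + ac below has coboundary a ∪ c.
    α δ : Cocycle N
    α = record
      { fun = λ g (_ , i) → (d₁₃ g xor a g ∧ b g) xor i ∧ b g
      ; lc = λ (_ , i) → lc₁₃ +lc lc-a *lc lc-b +lc lc-const i *lc lc-b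
      ; ∙-homo = λ g h (_ , i) → homo g h i
      }
      where
      table : ∀ i a a′ b b′ f f′ →
        (((f xor f′) xor a ∧ b′) xor ((a xor a′) xor false) ∧ ((b xor b′) xor false))
          xor i ∧ ((b xor b′) xor false)
        ≡ ((f xor a ∧ b) xor (i xor a′) ∧ b) xor (f′ xor a′ ∧ b′) xor i ∧ b′
      table = decided (∀ⁿ? 7 λ _ _ _ _ _ _ _ → _ ≟ _)
      homo : ∀ g h i → (d₁₃ (g ∙ h) xor a (g ∙ h) ∧ b (g ∙ h)) xor i ∧ b (g ∙ h)
        ≡ ((d₁₃ g xor a g ∧ b g) xor (i xor a h) ∧ b g) xor (d₁₃ h xor a h ∧ b h) xor i ∧ b h
      homo g h i rewrite ∂₁₃ g h | ∂a g h | ∂b g h = table i (a g) (a h) (b g) (b h) (d₁₃ g) (d₁₃ h)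
    δ = record
      { fun = λ g (_ , i) → d₃₅ g xor i ∧ c g
      ; lc = λ (_ , i) → lc₃₅ +lc lc-const i *lc lc-c
      ; ∙-homo = λ g h (_ , i) → homo g h i
      }
      where
      table : ∀ i a′ c c′ f f′ →
        ((f xor f′) xor c ∧ a′) xor i ∧ ((c xor c′) xor false)
        ≡ (f xor (i xor a′) ∧ c) xor f′ xor i ∧ c′
      table = decided (∀ⁿ? 6 λ _ _ _ _ _ _ → _ ≟ _)
      homo : ∀ g h i → d₃₅ (g ∙ h) xor i ∧ c (g ∙ h)
        ≡ (d₃₅ g xor (i xor a h) ∧ c g) xor d₃₅ h xor i ∧ c h
      homo g h i rewrite ∂₃₅ g h | ∂c g h = table i (a h) (c g) (c h) (d₃₅ g) (d₃₅ h)

    γ : Cocycle C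
    γ = record
      { fun = λ g (_ , k) → (d₃₅ g xor a g ∧ c g) xor k ∧ a g
      ; lc = λ (_ , k) → lc₃₅ +lc lc-a *lc lc-c +lc lc-const k *lc lc-a
      ; ∙-homo = λ g h (_ , k) → homo g h k
      }
      where
      table : ∀ k a a′ c c′ f f′ →
        (((f xor f′) xor c ∧ a′) xor ((a xor a′) xor false) ∧ ((c xor c′) xor false))
          xor k ∧ ((a xor a′) xor false)
        ≡ ((f xor a ∧ c) xor (k xor c′) ∧ a) xor (f′ xor a′ ∧ c′) xor k ∧ a′
      table = decided (∀ⁿ? 7 λ _ _ _ _ _ _ _ → _ ≟ _)
      homo : ∀ g h k → (d₃₅ (g ∙ h) xor a (g ∙ h) ∧ c (g ∙ h)) xor k ∧ a (g ∙ h)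
        ≡ ((d₃₅ g xor a g ∧ c g) xor (k xor c h) ∧ a g) xor (d₃₅ h xor a h ∧ c h) xor k ∧ a h
      homo g h k rewrite ∂₃₅ g h | ∂a g h | ∂c g h = table k (a g) (a h) (c g) (c h) (d₃₅ g) (d₃₅ h)

    -- The points of `D` are the vertices `(i , j)` of the square and those of `Y` its edges
    -- `(k , l)`. Flipping `j` gives the opposite vertex, flipping `l` the opposite edge.
    D Y : GSet
    D = N ⋉ δ
    Y = C ⋉ γ

    -- On C, the coboundary of e + k (d₁₃ + ab) is b ∪ γ.
    e : Carrier → Bool
    e g = (d₁₄ g xor d₂₅ g) xor a g ∧ d₂₄ g

    -- The equations for `d₁₄` and `d₂₅` make b ∪ γ a coboundary on `C`. A bounding cochain on the
    -- sheet `l = false`, with `b` added to it on the other sheet, is a cocycle on the double cover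
    -- whose corestriction is `b`.
    ω : Cocycle Y
    ω = record
      { fun = λ g ((_ , k) , l) → (e g xor k ∧ (d₁₃ g xor a g ∧ b g)) xor l ∧ b g
      ; lc = λ ((_ , k) , l) → lc₁₄ +lc lc₂₅ +lc lc-a *lc lc₂₄ +lc lc-const k *lc (lc₁₃ +lc lc-a *lc lc-b)
               +lc lc-const l *lc lc-b
      ; ∙-homo = λ g h ((_ , k) , l) → homo g h k l
      }
      where
      table-e : ∀ a a′ b c′ p p′ q q′ n n′ f h′ →
        (((p xor p′) xor a ∧ n′ xor f ∧ c′) xor ((q xor q′) xor b ∧ h′ xor n ∧ a′))
          xor ((a xor a′) xor false) ∧ ((n xor n′) xor b ∧ c′)
        ≡ (((p xor q) xor a ∧ n) xor ((p′ xor q′) xor a′ ∧ n′))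
          xor (f xor a ∧ b) ∧ c′ xor b ∧ (h′ xor a′ ∧ c′)
      table-e = decided (∀ⁿ? 12 λ _ _ _ _ _ _ _ _ _ _ _ _ → _ ≟ _)
      -- The product a d₂₄ has coboundary a ∪ d₂₄ + d₂₄ ∪ a + ab ∪ c + b ∪ ac, which removes `d₂₄`
      -- from the sum of the coboundaries of `d₁₄` and `d₂₅`.
      ∂e : e ∂≗ λ g h → (d₁₃ g xor a g ∧ b g) ∧ c h xor b g ∧ (d₃₅ h xor a h ∧ c h)
      ∂e g h rewrite ∂₁₄ g h | ∂₂₅ g h | ∂a g h | ∂₂₄ g h =
        table-e (a g) (a h) (b g) (c h) (d₁₄ g) (d₁₄ h) (d₂₅ g) (d₂₅ h) (d₂₄ g) (d₂₄ h) (d₁₃ g) (d₃₅ h)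
      table : ∀ k l a a′ b b′ c′ e e′ f f′ h′ →
        (((e xor e′) xor ((f xor a ∧ b) ∧ c′ xor b ∧ (h′ xor a′ ∧ c′)))
          xor k ∧ (((f xor f′) xor a ∧ b′) xor ((a xor a′) xor false) ∧ ((b xor b′) xor false)))
          xor l ∧ ((b xor b′) xor false)
        ≡ ((e xor (k xor c′) ∧ (f xor a ∧ b)) xor (l xor (h′ xor a′ ∧ c′) xor k ∧ a′) ∧ b)
          xor (e′ xor k ∧ (f′ xor a′ ∧ b′)) xor l ∧ b′
      table = decided (∀ⁿ? 12 λ _ _ _ _ _ _ _ _ _ _ _ _ → _ ≟ _)
      homo : ∀ g h k l →
        (e (g ∙ h) xor k ∧ (d₁₃ (g ∙ h) xor a (g ∙ h) ∧ b (g ∙ h))) xor l ∧ b (g ∙ h)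
        ≡ ((e g xor (k xor c h) ∧ (d₁₃ g xor a g ∧ b g))
              xor (l xor (d₃₅ h xor a h ∧ c h) xor k ∧ a h) ∧ b g)
          xor (e h xor k ∧ (d₁₃ h xor a h ∧ b h)) xor l ∧ b h
      homo g h k l rewrite ∂e g h | ∂₁₃ g h | ∂a g h | ∂b g h =
        table k l (a g) (a h) (b g) (b h) (c h) (e g) (e h) (d₁₃ g) (d₁₃ h) (d₃₅ h)

    -- Lifting modulo 4 and the new entries

    module _ {κ : Carrier → Bool} (hilbert90 : ∀ X → Hilbert90 κ X) where
      open Cocycle₄

      α̃ : Cocycle₄ κ N
      α̃ = proj₁ (hilbert90 N α)

      ω̃ : Cocycle₄ κ Y
      ω̃ = proj₁ (hilbert90 Y ω)

      ν : Cocycle₄ κ point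
      ν = corestriction {χ = χa} α̃

      defect : Cocycle₄ κ C
      defect = pullback {X = C} _ (λ _ _ → refl) ν ⊞ (⊟ corestriction {χ = γ} ω̃)

      -- Modulo 2, the corestrictions of `α` and of `ω` are both `b`.
      defect-even : ∀ g v → lo (fun defect g v) ≡ false
      defect-even g (_ , k) = trans
        (cong₂ _xor_ (cong₂ _xor_ (proj₂ (hilbert90 N α) g _) (proj₂ (hilbert90 N α) g _))
                     (cong₂ _xor_ (proj₂ (hilbert90 Y ω) g _) (proj₂ (hilbert90 Y ω) g _)))
        (table (d₁₃ g xor a g ∧ b g) (b g) (e g xor k ∧ (d₁₃ g xor a g ∧ b g)))
        where
        table : ∀ x b y → (((x xor false) xor x xor b) xor ((y xor false) xor y xor b)) ≡ false
        table = decided (∀ⁿ? 3 λ _ _ _ → _ ≟ _)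

      r : Cocycle C
      r = half defect defect-even

      r̃ : Cocycle₄ κ C
      r̃ = proj₁ (hilbert90 C r)

      -- A class pulled back from `C` has twice itself as corestriction, so adding `r̃` adds 2r̃,
      -- which is exactly `defect`.
      ω̃′ : Cocycle₄ κ Y
      ω̃′ = ω̃ ⊞ pullback {X = Y} proj₁ (λ _ _ → refl) r̃

      ω̃′-norm : ∀ g k → fun ω̃′ g (k , false) ⊕ fun ω̃′ g (k , true) ≡ fun ν g tt
      ω̃′-norm g k = table (fun ω̃ g (k , false)) (fun ω̃ g (k , true)) (fun r̃ g k) (fun ν g tt)
        (cong₂ _,_ (defect-even g k) (sym (proj₂ (hilbert90 C r) g k)))
        where
        table : ∀ x y z n → n ⊕ ⊖ (x ⊕ y) ≡ double z → (x ⊕ z) ⊕ (y ⊕ z) ≡ n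
        table = decided (∀ℤ₄? λ _ → ∀ℤ₄? λ _ → ∀ℤ₄? λ _ → ∀ℤ₄? λ _ → (_ ≟₄ _) →-dec (_ ≟₄ _))

      χc-D : Cocycle D
      χc-D = character lc-c ∂c D

      -- The vertex (i , j) lies on the edges (k , j + i k) for k = 0, 1.
      incident : Point (D ⋉ χc-D) → Point Y
      incident (((_ , i) , j) , k) = (tt , k) , j xor i ∧ k

      ζ₂ : Cocycle₄ κ D
      ζ₂ = pullback {X = D} proj₁ (λ _ _ → refl) α̃
         -- The points of `D ⋉ χc-D` are the incident pairs of a vertex and an edge; summing over
         -- `k` collects the two edges at a vertex.
         ⊞ corestriction {χ = χc-D} (pullback {X = D ⋉ χc-D} incident equivariant ω̃′)
         ⊞ (⊟ pullback {X = D} _ (λ _ _ → refl) ν)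
        where
        table : ∀ i j k a c h → (j xor h xor i ∧ c) xor (i xor a) ∧ (k xor c)
                              ≡ (j xor i ∧ k) xor (h xor a ∧ c) xor k ∧ a
        table = decided (∀ⁿ? 6 λ _ _ _ _ _ _ → _ ≟ _)
        equivariant : ∀ g v → incident (GSet._▹_ (D ⋉ χc-D) g v) ≡ GSet._▹_ Y g (incident v)
        equivariant g (((_ , i) , j) , k) = cong ((tt , k xor c g) ,_) (table i j k (a g) (c g) (d₃₅ g))

      -- The dependence on the vertex `(i , j)` is i b from `α` and j b, (j + i) b from its two
      -- edges, and these add up to zero. What is left is the corestriction of `r` plus `b`.
      lo-ζ₂ : ∀ g v → lo (fun ζ₂ g v) ≡ lo (fun ζ₂ g ((tt , false) , false))
      lo-ζ₂ g ((_ , i) , j) = trans (expand i j) (trans (table i j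
          (d₁₃ g xor a g ∧ b g) (b g) (e g)
          (lo (fun r̃ g (tt , false))) (lo (fun r̃ g (tt , true))) (lo (fun ν g tt))) (sym (expand false false)))
        where
        expand : ∀ i j → lo (fun ζ₂ g ((tt , i) , j)) ≡
          (((d₁₃ g xor a g ∧ b g) xor i ∧ b g)
           xor (((e g xor false) xor (j xor i ∧ false) ∧ b g) xor lo (fun r̃ g (tt , false)))
           xor (((e g xor (d₁₃ g xor a g ∧ b g)) xor (j xor i ∧ true) ∧ b g) xor lo (fun r̃ g (tt , true))))
          xor lo (fun ν g tt)
        expand i j = cong (_xor _) (cong₂ _xor_ (proj₂ (hilbert90 N α) g _)
          (cong₂ _xor_ (cong (_xor _) (proj₂ (hilbert90 Y ω) g _))
                       (cong (_xor _) (proj₂ (hilbert90 Y ω) g _))))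
        table : ∀ i j x b e r r′ n →
          ((x xor i ∧ b) xor (((e xor false) xor (j xor i ∧ false) ∧ b) xor r)
                         xor (((e xor x) xor (j xor i ∧ true) ∧ b) xor r′)) xor n
          ≡ ((x xor false) xor (((e xor false) xor false) xor r)
                           xor (((e xor x) xor false) xor r′)) xor n
        table = decided (∀ⁿ? 8 λ _ _ _ _ _ _ _ _ → _ ≟ _)

      ρ : Cocycle point
      ρ = record
        { fun = λ g _ → Cocycle.fun (reduction₂ ζ₂) g v₀
        ; lc = λ _ → Cocycle.lc (reduction₂ ζ₂) v₀
        ; ∙-homo = λ g h _ → trans (Cocycle.∙-homo (reduction₂ ζ₂) g h v₀)
            (cong (_xor _) (lo-ζ₂ g (GSet._▹_ D h v₀)))
        }
        where
        v₀ : Point D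
        v₀ = (tt , false) , false

      ρ̃ : Cocycle₄ κ point
      ρ̃ = proj₁ (hilbert90 point ρ)

      2ζ : Cocycle₄ κ D
      2ζ = ζ₂ ⊞ (⊟ pullback {X = D} _ (λ _ _ → refl) ρ̃)

      2ζ-even : ∀ g v → lo (fun 2ζ g v) ≡ false
      2ζ-even g v = trans (cong₂ _xor_ (lo-ζ₂ g v) (proj₂ (hilbert90 point ρ) g tt))
        (xor-same (Cocycle.fun ρ g tt))

      ζ : Cocycle D
      ζ = half 2ζ 2ζ-even

      -- The vertices `(i , false)` and `(i , true)` are opposite, so between them they meet each
      -- edge of the square once, and by `ω̃′-norm` the edges contribute 2ν. This cancels the two
      -- copies of -ν in `ζ₂`. The corestriction of `2ζ` is therefore 2α̃ - 2ρ̃, whose high bit is α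
      -- + ρ.
      ζ-norm : ∀ g i → Cocycle.fun ζ g ((tt , i) , false) xor Cocycle.fun ζ g ((tt , i) , true)
                     ≡ Cocycle.fun α g (tt , i) xor Cocycle.fun ρ g tt
      ζ-norm g i = trans (hi-⊕ (fun 2ζ g ((tt , i) , false)) (fun 2ζ g ((tt , i) , true)) (2ζ-even g ((tt , i) , false)))
        (trans (cong hi (sum i))
          (cong₂ _xor_ (proj₂ (hilbert90 N α) g (tt , i)) (proj₂ (hilbert90 point ρ) g tt)))
        where
        hi-⊕ : ∀ x y → lo x ≡ false → hi x xor hi y ≡ hi (x ⊕ y)
        hi-⊕ = decided (∀ℤ₄? λ _ → ∀ℤ₄? λ _ → (_ ≟ _) →-dec (_ ≟ _))
        table : ∀ x s s′ t t′ n → s ⊕ s′ ≡ n → t ⊕ t′ ≡ n → ∀ r →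
          ((x ⊕ (s ⊕ t) ⊕ ⊖ n) ⊕ ⊖ r) ⊕ ((x ⊕ (s′ ⊕ t′) ⊕ ⊖ n) ⊕ ⊖ r) ≡ (false , lo x xor lo r)
        table = decided (∀ℤ₄? λ _ → ∀ℤ₄? λ _ → ∀ℤ₄? λ _ → ∀ℤ₄? λ _ → ∀ℤ₄? λ _ → ∀ℤ₄? λ _ →
          (_ ≟₄ _) →-dec ((_ ≟₄ _) →-dec (∀ℤ₄? λ _ → _ ≟₄ _)))
        ⊕-comm : ∀ x y → x ⊕ y ≡ y ⊕ x
        ⊕-comm = decided (∀ℤ₄? λ _ → ∀ℤ₄? λ _ → _ ≟₄ _)
        w : Bool → Bool → ℤ₄
        w k l = fun ω̃′ g ((tt , k) , l)
        sum : ∀ i → fun 2ζ g ((tt , i) , false) ⊕ fun 2ζ g ((tt , i) , true)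
                  ≡ (false , lo (fun α̃ g (tt , i)) xor lo (fun ρ̃ g tt))
        sum false = table (fun α̃ g (tt , false)) (w false false) (w false true) (w true false) (w true true)
          (fun ν g tt) (ω̃′-norm g (tt , false)) (ω̃′-norm g (tt , true)) (fun ρ̃ g tt)
        -- The vertex `(true , false)` lies on the edge `(true , true)`, so the two edges with
        -- `k = true` occur in the opposite order.
        sum true  = table (fun α̃ g (tt , true)) (w false false) (w false true) (w true true) (w true false)
          (fun ν g tt) (ω̃′-norm g (tt , false))
          (trans (⊕-comm (w true true) (w true false)) (ω̃′-norm g (tt , true))) (fun ρ̃ g tt)

      -- On N, the coboundary of ψ is (α + ρ) ∪ δ.
      ψ : Bool → Carrier → Bool
      ψ i g = Cocycle.fun ζ g ((tt , i) , false)

      -- Write ψ₀, ψ₁ for `ψ false`, `ψ true`. On all of G the coboundary of ψ₀ is d₁₃′ ∪ d₃₅ + (ψ₀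
      -- + ψ₁) ∪ a + ab ∪ d₃₅ + b ∪ a d₃₅. Adding a d₂₅ cancels the last two terms and brings in a ∪
      -- d₂₅; `d₁₄′` gathers everything that then stands to the left of `a`.
      d₁₃′ d₁₄′ d₁₅′ : Carrier → Bool
      d₁₃′ g = d₁₃ g xor Cocycle.fun ρ g tt
      d₁₄′ g = ((ψ false g xor ψ true g) xor d₂₅ g) xor (d₂₄ g xor a g ∧ d₂₄ g)
      d₁₅′ g = ψ false g xor a g ∧ d₂₅ g

      -- The sheet `j = true` is recovered from `j = false` by `ζ-norm`, and the dependence on `i`
      -- is interpolated. A polynomial in `i` and `j` is needed because the cocycle rule evaluates
      -- `ζ` at vertices moved by `h`.
      ζ-fun : ∀ g i j → Cocycle.fun ζ g ((tt , i) , j) ≡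
        (ψ false g xor i ∧ (ψ false g xor ψ true g))
          xor j ∧ (((d₁₃ g xor a g ∧ b g) xor i ∧ b g) xor Cocycle.fun ρ g tt)
      ζ-fun g i j = trans (on-sheet i j) (cong₂ _xor_ (interpolate i) refl)
        where
        interpolate : ∀ i → ψ i g ≡ ψ false g xor i ∧ (ψ false g xor ψ true g)
        interpolate false = sym (xor-identityʳ (ψ false g))
        interpolate true = table (ψ false g) (ψ true g)
          where
          table : ∀ x y → y ≡ x xor x xor y
          table = decided (∀ⁿ? 2 λ _ _ → _ ≟ _)
        on-sheet : ∀ i j → Cocycle.fun ζ g ((tt , i) , j) ≡
          ψ i g xor j ∧ (((d₁₃ g xor a g ∧ b g) xor i ∧ b g) xor Cocycle.fun ρ g tt)
        on-sheet i false = sym (xor-identityʳ (ψ i g))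
        on-sheet i true  = table (ψ i g) _ _ (ζ-norm g i)
          where
          table : ∀ x y z → x xor y ≡ z → y ≡ x xor z
          table = decided (∀ⁿ? 3 λ _ _ _ → (_ ≟ _) →-dec (_ ≟ _))

      ψ-∙ : ∀ i g h → ψ i (g ∙ h) ≡
        ((ψ false g xor (i xor a h) ∧ (ψ false g xor ψ true g)) xor (d₃₅ h xor i ∧ c h) ∧
          (((d₁₃ g xor a g ∧ b g) xor (i xor a h) ∧ b g) xor Cocycle.fun ρ g tt)) xor ψ i h
      ψ-∙ i g h = trans (Cocycle.∙-homo ζ g h ((tt , i) , false))
        (cong (_xor _) (ζ-fun g (i xor a h) (d₃₅ h xor i ∧ c h)))

      lc-ψ : ∀ i → LC (ψ i)
      lc-ψ i = Cocycle.lc ζ ((tt , i) , false)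

      -- The functions `x` and `y` replace the entries (1,3) and (1,4), and `z` bounds the value of
      -- the resulting system. The entries (2,4), (2,5) and (3,5) do not involve these two and stay
      -- as they are.
      correction : Σ[ x ∈ (Carrier → Bool) ] Σ[ y ∈ (Carrier → Bool) ] Σ[ z ∈ (Carrier → Bool) ]
        LC x × LC y × LC z ×
        (x ∂≗ a ∪ b) × (y ∂≗ a ∪ d₂₄ ⊹ x ∪ c) × (z ∂≗ a ∪ d₂₅ ⊹ x ∪ d₃₅ ⊹ y ∪ a)
      correction = d₁₃′ , d₁₄′ , d₁₅′
        , lc₁₃ +lc Cocycle.lc ρ tt
        , lc-ψ false +lc lc-ψ true +lc lc₂₅ +lc (lc₂₄ +lc lc-a *lc lc₂₄)
        , lc-ψ false +lc lc-a *lc lc₂₅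
        , ∂₁₃′ , ∂₁₄′ , ∂₁₅′
        where
        table₁₃ : ∀ a b′ f f′ r r′ → ((f xor f′) xor a ∧ b′) xor (r xor r′) ≡ ((f xor r) xor (f′ xor r′)) xor a ∧ b′
        table₁₃ = decided (∀ⁿ? 6 λ _ _ _ _ _ _ → _ ≟ _)
        ∂₁₃′ : d₁₃′ ∂≗ a ∪ b
        ∂₁₃′ g h = trans (cong₂ _xor_ (∂₁₃ g h) (Cocycle.∙-homo ρ g h tt))
          (table₁₃ (a g) (b h) (d₁₃ g) (d₁₃ h) (Cocycle.fun ρ g tt) (Cocycle.fun ρ h tt))

        table₁₄ : ∀ a a′ b c′ f r h′ n n′ q q′ u v u′ v′ →
          (((((u xor a′ ∧ (u xor v)) xor (h′ xor false) ∧ (((f xor a ∧ b) xor a′ ∧ b) xor r)) xor u′)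
            xor (((u xor not a′ ∧ (u xor v)) xor (h′ xor c′) ∧ (((f xor a ∧ b) xor not a′ ∧ b) xor r)) xor v′))
            xor ((q xor q′) xor b ∧ h′ xor n ∧ a′))
            xor (((n xor n′) xor b ∧ c′) xor ((a xor a′) xor false) ∧ ((n xor n′) xor b ∧ c′))
          ≡ ((((u xor v) xor q) xor (n xor a ∧ n)) xor (((u′ xor v′) xor q′) xor (n′ xor a′ ∧ n′)))
            xor a ∧ n′ xor (f xor r) ∧ c′
        table₁₄ = decided (∀ⁿ? 15 λ _ _ _ _ _ _ _ _ _ _ _ _ _ _ _ → _ ≟ _)
        ∂₁₄′ : d₁₄′ ∂≗ a ∪ d₂₄ ⊹ d₁₃′ ∪ c
        ∂₁₄′ g h = trans
          (cong₂ _xor_ (cong₂ _xor_ (cong₂ _xor_ (ψ-∙ false g h) (ψ-∙ true g h)) (∂₂₅ g h))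
                       (cong₂ _xor_ (∂₂₄ g h) (cong₂ _∧_ (∂a g h) (∂₂₄ g h))))
          (table₁₄ (a g) (a h) (b g) (c h) (d₁₃ g) (Cocycle.fun ρ g tt) (d₃₅ h) (d₂₄ g) (d₂₄ h)
                   (d₂₅ g) (d₂₅ h) (ψ false g) (ψ true g) (ψ false h) (ψ true h))

        table₁₅ : ∀ a a′ b f r h′ n q q′ u v u′ →
          (((u xor a′ ∧ (u xor v)) xor (h′ xor false) ∧ (((f xor a ∧ b) xor a′ ∧ b) xor r)) xor u′)
            xor ((a xor a′) xor false) ∧ ((q xor q′) xor b ∧ h′ xor n ∧ a′)
          ≡ ((u xor a ∧ q) xor (u′ xor a′ ∧ q′))
            xor a ∧ q′ xor (f xor r) ∧ h′ xor (((u xor v) xor q) xor (n xor a ∧ n)) ∧ a′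
        table₁₅ = decided (∀ⁿ? 12 λ _ _ _ _ _ _ _ _ _ _ _ _ → _ ≟ _)
        ∂₁₅′ : d₁₅′ ∂≗ a ∪ d₂₅ ⊹ d₁₃′ ∪ d₃₅ ⊹ d₁₄′ ∪ a
        ∂₁₅′ g h = trans
          (cong₂ _xor_ (ψ-∙ false g h) (cong₂ _∧_ (∂a g h) (∂₂₅ g h)))
          (table₁₅ (a g) (a h) (b g) (d₁₃ g) (Cocycle.fun ρ g tt) (d₃₅ h) (d₂₄ g)
                   (d₂₅ g) (d₂₅ h) (ψ false g) (ψ true g) (ψ false h))

  -- Formal Hilbert 90 for finite G-sets

  module _ (θ : Orientation 2 G) where
    private module θ = Orientation θ

    θ-mod θ⁻¹-mod : Carrier → ℕ → ℤ
    θ-mod g n = ℤₚ.residue (ℤₚˣ.unit (θ.θ g)) n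
    θ⁻¹-mod g n = ℤₚ.residue (ℤₚˣ.inv (θ.θ g)) n

    θ₄ : Carrier → ℤ₄
    θ₄ g = residue₄ (θ-mod g 2)

    -- θ ≡ (-1)^κ modulo 4
    κ : Carrier → Bool
    κ g = hi (θ₄ g)

    θ₄-odd : ∀ g → lo (θ₄ g) ≡ true
    θ₄-odd g = table (θ₄ g) (residue₄ (θ⁻¹-mod g 2))
      (trans (sym (residue₄-* (θ-mod g 2) (θ⁻¹-mod g 2))) (residue₄-cong (ℤₚˣ.inverse (θ.θ g) 2)))
      where
      table : ∀ x y → x ⊗ y ≡ (true , false) → lo x ≡ true
      table = decided (∀ℤ₄? λ _ → ∀ℤ₄? λ _ → (_ ≟₄ _) →-dec (_ ≟ _))

    ⊗-twisted : ∀ g x → θ₄ g ⊗ x ≡ twisted (κ g) x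
    ⊗-twisted g x = table (θ₄ g) x (θ₄-odd g)
      where
      table : ∀ t x → lo t ≡ true → t ⊗ x ≡ twisted (hi t) x
      table = decided (∀ℤ₄? λ _ → ∀ℤ₄? λ _ → (_ ≟ _) →-dec (_ ≟₄ _))

    κ-∙ : ∀ g h → κ (g ∙ h) ≡ κ g xor κ h
    κ-∙ g h = trans
      (cong hi (trans (residue₄-cong (IsGroupHomomorphism.homo θ.θ-homo g h 2))
                      (residue₄-* (θ-mod g 2) (θ-mod h 2))))
      (table (θ₄ g) (θ₄ h) (θ₄-odd g) (θ₄-odd h))
      where
      table : ∀ x y → lo x ≡ true → lo y ≡ true → hi (x ⊗ y) ≡ hi x xor hi y
      table = decided (∀ℤ₄? λ _ → ∀ℤ₄? λ _ → (_ ≟ _) →-dec ((_ ≟ _) →-dec (_ ≟ _)))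

    κ-lc : LocallyConstant κ
    κ-lc g = let U , Uo , g∈U , c = θ.θ-continuous 2 g
             in U , Uo , g∈U , λ h∈U → cong hi (residue₄-cong (c h∈U))

    θ-parity : ∀ g → parity (θ-mod g 1) ≡ true
    θ-parity g = table _ (parity (θ⁻¹-mod g 1))
      (trans (sym (parity-* (θ-mod g 1) (θ⁻¹-mod g 1))) (parity-cong (ℤₚˣ.inverse (θ.θ g) 1)))
      where
      table : ∀ x y → x ∧ y ≡ true → x ≡ true
      table = decided (∀ⁿ? 2 λ _ _ → (_ ≟ _) →-dec (_ ≟ _))

    -- The subgroup is given by its indicator `P`, and the lift is returned as a function on all of
    -- G, zero off the subgroup. Arguments can then be conjugated and translated without carrying
    -- membership proofs.
    module SubgroupLift (hilbert90 : FormalHilbert90 θ)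
      {P χ : Carrier → Bool} (P-lc : LocallyConstant P) (χ-lc : LocallyConstant χ)
      (P-ε : P ε ≡ true)
      (P-∙ : ∀ {g h} → P g ≡ true → P h ≡ true → P (g ∙ h) ≡ true)
      (P-⁻¹ : ∀ {g} → P g ≡ true → P (g ⁻¹) ≡ true)
      (χ-∙ : ∀ {g h} → P g ≡ true → P h ≡ true → χ (g ∙ h) ≡ χ g xor χ h)
      where

      private
        K : OpenSubgroup G
        K = record
          { member = λ g → Lift u (P g ≡ true)
          ; isOpen = lc-open P-lc
          ; ε-closed = lift P-ε
          ; ∙-closed = λ p q → lift (P-∙ (lower p) (lower q))
          ; ⁻¹-closed = λ p → lift (P-⁻¹ (lower p))
          }

        module K = OpenSubgroup K

        M : ℕ → DiscreteModule K.topologicalGroup _ _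
        M n = restrict K (twist θ n)

        open Cochain using (fun; continuous)

        χ-cochain : Cochain K.topologicalGroup (M 1) 1
        χ-cochain = record
          { fun = λ { (g ∷ []) → bit (χ (proj₁ g)) }
          ; cong = λ { {_ ∷ []} {_ ∷ []} (e ∷ []) → mod-reflexive 2 (cong bit (lc-resp χ-lc e)) }
          ; continuous = λ { (g ∷ []) →
              let U , Uo , g∈U , c = χ-lc (proj₁ g)
              in near (U ∘ proj₁ ∷ []) ((U , Uo , id , id) ∷ []) (g∈U ∷ [])
                      λ { {_ ∷ []} (h∈U ∷ []) → mod-reflexive 2 (cong bit (c h∈U)) } }
          }

        χ-cocycle : ∀ x → fun (coboundary K.topologicalGroup (M 1) χ-cochain) x ≡ 0ℤ [mod 2 ]
        χ-cocycle ((g , p) ∷ (h , q) ∷ []) = parity-reflects (begin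
          parity (t ℤ.* bit (χ h) ℤ.+ (ℤ.- bit (χ (g ∙ h)) ℤ.+ 0ℤ) ℤ.+ ℤ.- (ℤ.- bit (χ g)))
            ≡⟨ trans (parity-+ (t ℤ.* bit (χ h) ℤ.+ (ℤ.- bit (χ (g ∙ h)) ℤ.+ 0ℤ)) _)
                 (cong₂ _xor_ (trans (parity-+ (t ℤ.* bit (χ h)) _)
                    (cong₂ _xor_ (trans (parity-* t _) (cong₂ _∧_ (θ-parity g) (parity-bit (χ h))))
                                 (trans (parity-+ (ℤ.- bit (χ (g ∙ h))) 0ℤ) (cong (_xor false)
                                   (trans (parity-neg (bit (χ (g ∙ h)))) (parity-bit (χ (g ∙ h))))))))
                    (trans (parity-neg (ℤ.- bit (χ g))) (trans (parity-neg (bit (χ g))) (parity-bit (χ g))))) ⟩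
          (χ h xor (χ (g ∙ h) xor false)) xor χ g
            ≡⟨ cong (λ x → (χ h xor (x xor false)) xor χ g) (χ-∙ (lower p) (lower q)) ⟩
          (χ h xor ((χ g xor χ h) xor false)) xor χ g
            ≡⟨ table (χ g) (χ h) ⟩
          false ∎)
          where
          open ≡-Reasoning
          t : ℤ
          t = θ-mod g 1
          table : ∀ x y → (y xor ((x xor y) xor false)) xor x ≡ false
          table = decided (∀ⁿ? 2 λ _ _ → _ ≟ _)

        lifted : ∃ _
        lifted = hilbert90 K 2 (s≤s z≤n) (χ-cochain , χ-cocycle)

        F : Cochain K.topologicalGroup (M 2) 1
        F = proj₁ (proj₁ lifted)

        F₄ : ∃ K.member → ℤ₄
        F₄ g = residue₄ (fun F (g ∷ []))

        module C₂ = RawComplex (cochainComplex K.topologicalGroup (M 2))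

        -- `Surjective` yields its equation for every class equal to the chosen preimage, so
        -- reflexivity is needed; the zero 0-cochain witnesses it.
        F-≈H : C₂._≈H_ {1} (proj₁ lifted) (proj₁ lifted)
        F-≈H = C₂.0# {0} , λ x → mod-trans 4
          (IsGroupHomomorphism.ε-homo (C₂.∂-homo {0}) x)
          (mod-sym 4 (AbelianGroup.inverseʳ (C₂.degree 1) F x))

        -- θ is odd, so the coboundary of a 0-cochain z, namely θ(g) z - z, vanishes modulo 2.
        -- Cohomologous 1-cocycles modulo 2 are thus equal, and the lift reduces to `χ` exactly.
        F-parity : ∀ g → lo (F₄ g) ≡ χ (proj₁ g)
        F-parity g = let z , ∂z = proj₂ lifted {proj₁ lifted} F-≈H in
          final (fun z []) (∂z (g ∷ []))
          where
          t : ℤ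
          t = θ-mod (proj₁ g) 1
          table : ∀ z f x → (z xor false) xor z ≡ f xor x → f ≡ x
          table = decided (∀ⁿ? 3 λ _ _ _ → (_ ≟ _) →-dec (_ ≟ _))
          final : ∀ z → t ℤ.* z ℤ.+ 0ℤ ℤ.+ ℤ.- z ≡ fun F (g ∷ []) ℤ.+ ℤ.- bit (χ (proj₁ g)) [mod 2 ] →
                  lo (F₄ g) ≡ χ (proj₁ g)
          final z e = table (parity z) _ _ (begin
            (parity z xor false) xor parity z ≡⟨ cong (λ s → (s ∧ parity z xor false) xor parity z) (θ-parity (proj₁ g)) ⟨
            (parity t ∧ parity z xor false) xor parity z
              ≡⟨ cong₂ (λ x y → (x xor false) xor y) (parity-* t z) (parity-neg z) ⟨
            (parity (t ℤ.* z) xor false) xor parity (ℤ.- z) ≡⟨ cong (_xor parity (ℤ.- z)) (parity-+ (t ℤ.* z) 0ℤ) ⟨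
            parity (t ℤ.* z ℤ.+ 0ℤ) xor parity (ℤ.- z) ≡⟨ parity-+ (t ℤ.* z ℤ.+ 0ℤ) (ℤ.- z) ⟨
            parity (t ℤ.* z ℤ.+ 0ℤ ℤ.+ ℤ.- z) ≡⟨ parity-cong e ⟩
            parity (fun F (g ∷ []) ℤ.+ ℤ.- bit (χ (proj₁ g))) ≡⟨ parity-+ (fun F (g ∷ [])) _ ⟩
            lo (F₄ g) xor parity (ℤ.- bit (χ (proj₁ g)))
              ≡⟨ cong (lo (F₄ g) xor_) (trans (parity-neg (bit (χ (proj₁ g)))) (parity-bit (χ (proj₁ g)))) ⟩
            lo (F₄ g) xor χ (proj₁ g) ∎)
            where open ≡-Reasoning

        F-∙ : ∀ g h → F₄ (TopologicalGroup._∙_ K.topologicalGroup g h) ≡ F₄ g ⊕ twisted (κ (proj₁ g)) (F₄ h)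
        F-∙ g h = table (F₄ g) (twisted (κ (proj₁ g)) (F₄ h)) _ (begin
          (twisted (κ (proj₁ g)) (F₄ h) ⊕ (⊖ F₄ gh ⊕ (false , false))) ⊕ ⊖ ⊖ F₄ g
            ≡⟨ cong₂ _⊕_ (cong₂ _⊕_ (trans (residue₄-* t (fun F (h ∷ []))) (⊗-twisted (proj₁ g) (F₄ h)))
                 (trans (residue₄-+ (ℤ.- fun F (gh ∷ [])) 0ℤ) (cong (_⊕ (false , false)) (residue₄-neg (fun F (gh ∷ []))))))
                 (trans (residue₄-neg (ℤ.- fun F (g ∷ []))) (cong ⊖_ (residue₄-neg (fun F (g ∷ []))))) ⟨
          (residue₄ (t ℤ.* fun F (h ∷ [])) ⊕ residue₄ (ℤ.- fun F (gh ∷ []) ℤ.+ 0ℤ)) ⊕ residue₄ (ℤ.- (ℤ.- fun F (g ∷ [])))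
            ≡⟨ cong (_⊕ residue₄ (ℤ.- (ℤ.- fun F (g ∷ [])))) (residue₄-+ (t ℤ.* fun F (h ∷ [])) _) ⟨
          residue₄ (t ℤ.* fun F (h ∷ []) ℤ.+ (ℤ.- fun F (gh ∷ []) ℤ.+ 0ℤ)) ⊕ residue₄ (ℤ.- (ℤ.- fun F (g ∷ [])))
            ≡⟨ residue₄-+ (t ℤ.* fun F (h ∷ []) ℤ.+ (ℤ.- fun F (gh ∷ []) ℤ.+ 0ℤ)) _ ⟨
          residue₄ (t ℤ.* fun F (h ∷ []) ℤ.+ (ℤ.- fun F (gh ∷ []) ℤ.+ 0ℤ) ℤ.+ ℤ.- (ℤ.- fun F (g ∷ [])))
            ≡⟨ residue₄-cong (proj₂ (proj₁ lifted) (g ∷ h ∷ [])) ⟩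
          (false , false) ∎)
          where
          open ≡-Reasoning
          t : ℤ
          t = θ-mod (proj₁ g) 2
          gh : ∃ K.member
          gh = TopologicalGroup._∙_ K.topologicalGroup g h
          table : ∀ x y z → (y ⊕ (⊖ z ⊕ (false , false))) ⊕ ⊖ ⊖ x ≡ (false , false) → z ≡ x ⊕ y
          table = decided (∀ℤ₄? λ _ → ∀ℤ₄? λ _ → ∀ℤ₄? λ _ → (_ ≟₄ _) →-dec (_ ≟₄ _))

        extend : ∀ g b → P g ≡ b → ℤ₄
        extend g true  p = F₄ (g , lift p)
        extend g false _ = false , false

        φ : Carrier → ℤ₄
        φ g = extend g (P g) refl

        φ-on : ∀ {g} (p : P g ≡ true) → φ g ≡ F₄ (g , lift p)
        φ-on {g} p = agree (P g) refl p
          where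
          agree : ∀ b (q : P g ≡ b) p → extend g b q ≡ F₄ (g , lift p)
          -- The two membership proofs may differ, but equality in the subgroup only compares the
          -- underlying elements.
          agree true  q p = residue₄-cong (Cochain.cong F (≈-refl ∷ []))
          agree false q p with () ← trans (sym q) p

        φ-off : ∀ {g} → P g ≡ false → φ g ≡ (false , false)
        φ-off {g} p = agree (P g) refl p
          where
          agree : ∀ b (q : P g ≡ b) → P g ≡ false → extend g b q ≡ (false , false)
          agree false q p = refl
          agree true  q p with () ← trans (sym q) p

        φ-lc : LocallyConstant φ
        φ-lc x = at (P x) refl
          where
          at : ∀ b → P x ≡ b → Σ[ U ∈ Pred Carrier u ] IsOpen U × U x × (∀ {y} → U y → φ y ≡ φ x)
          at false p =
            let U , Uo , x∈U , c = P-lc x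
            in U , Uo , x∈U , λ y∈U → trans (φ-off (trans (c y∈U) p)) (sym (φ-off p))
          at true p with near (V ∷ []) ((W , Wo , V⊆W , W⊆V) ∷ []) (x∈V ∷ []) d ← continuous F ((x , lift p) ∷ []) =
            let U , Uo , x∈U , c = P-lc x
            in _ , open-∩ Uo Wo , (x∈U , V⊆W x∈V) , λ {y} (y∈U , y∈W) →
               let q = trans (c y∈U) p
               in trans (φ-on q) (trans (residue₄-cong (d (W⊆V {y , lift q} y∈W ∷ []))) (sym (φ-on p)))

      lift-subgroup : Σ[ f ∈ (Carrier → ℤ₄) ] LocallyConstant f ×
        (∀ {g} → P g ≡ true → lo (f g) ≡ χ g) ×
        (∀ {g h} → P g ≡ true → P h ≡ true → f (g ∙ h) ≡ f g ⊕ twisted (κ g) (f h))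
      lift-subgroup = φ , φ-lc
        , (λ p → trans (cong lo (φ-on p)) (F-parity _))
        , (λ {g} p q → trans (φ-on (P-∙ p q)) (trans (F-∙ (_ , lift p) (_ , lift q))
                     (sym (cong₂ (λ x y → x ⊕ twisted (κ g) y) (φ-on p) (φ-on q)))))

  -- From stabilisers to whole orbits

  module OrbitLift (em : ∀ {ℓ} → ExcludedMiddle ℓ) (θ : Orientation 2 G) (hilbert90 : FormalHilbert90 θ)
                   (X : GSet) (χ : Cocycle X) where
    open GSet X renaming (Point to Ω)
    private module χ = Cocycle χ

    private
      ⁻¹-▹ : ∀ {g v w} → g ▹ v ≡ w → g ⁻¹ ▹ w ≡ v
      ⁻¹-▹ {g} {v} refl = trans (sym (∙-▹ (g ⁻¹) g v))
        (trans (lc-resp (▹-lc v) (inverseˡ g)) (ε-▹ v))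

      Above : Ω → Ω → Set u
      Above v w = ∃[ g ] g ▹ w ≡ v

      above? : Ω → Ω → Bool
      above? v w = does (em {P = Above v w})

      above-self : ∀ v → above? v v ≡ true
      above-self v = dec-true em (ε , ε-▹ v)

      rep : Ω → Ω
      rep v = firstWith (above? v) v points

      above-rep : ∀ v → Above v (rep v)
      above-rep v = from-does em (firstWith-holds {P = above? v} points (complete v) (above-self v))

      -- The points `v` and `g ▹ v` can be reached from the same points, so both searches run
      -- through `points` with equivalent tests.
      rep-▹ : ∀ g v → rep (g ▹ v) ≡ rep v
      rep-▹ g v = sym (firstWith-cong points same (complete v) (above-self v))
        where
        same : ∀ w → above? v w ≡ above? (g ▹ v) w
        same w = does-⇔ (mk⇔
          (λ (h , hw≡v) → g ∙ h , trans (∙-▹ g h w) (cong (g ▹_) hw≡v))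
          (λ (h , hw≡gv) → g ⁻¹ ∙ h , trans (∙-▹ (g ⁻¹) h w) (⁻¹-▹ (sym hw≡gv)))) em em

      τ : Ω → Carrier
      τ v = proj₁ (above-rep v)

      τ-rep : ∀ v → τ v ▹ rep v ≡ v
      τ-rep v = proj₂ (above-rep v)

      stabilises : Ω → Carrier → Bool
      stabilises s g = does (em {P = g ▹ s ≡ s})

      stabilises⁺ : ∀ {s g} → g ▹ s ≡ s → stabilises s g ≡ true
      stabilises⁺ = dec-true em

      stabilises⁻ : ∀ {s g} → stabilises s g ≡ true → g ▹ s ≡ s
      stabilises⁻ = from-does em

      stabiliser-lift : ∀ s → _
      stabiliser-lift s = SubgroupLift.lift-subgroup θ hilbert90 {P = stabilises s} {χ = λ g → χ.fun g s}
        (lc-map (λ w → does (em {P = w ≡ s})) (▹-lc s)) (χ.lc s)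
        (stabilises⁺ (ε-▹ s))
        (λ {g} {h} p q → stabilises⁺ (trans (∙-▹ g h s) (trans (cong (g ▹_) (stabilises⁻ q)) (stabilises⁻ p))))
        (λ p → stabilises⁺ (⁻¹-▹ (stabilises⁻ p)))
        (λ {g} {h} p q → trans (χ.∙-homo g h s) (cong (λ w → χ.fun g w xor χ.fun h s) (stabilises⁻ q)))

      φ : Ω → Carrier → ℤ₄
      φ s = proj₁ (stabiliser-lift s)

      -- The value prescribed for the lift on the arrow `τ v` from `rep v` to `v`. Since
      -- `τ w ∙ loop w v g ≈ g ∙ τ v`, the cocycle rule then expresses the value on any arrow
      -- through the values on loops at the representative.
      base : Ω → ℤ₄
      base v = χ.fun (τ v) (rep v) , false

      loop : Ω → Ω → Carrier → Carrier
      loop w v g = τ w ⁻¹ ∙ g ∙ τ v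

      τ-loop : ∀ w v g → τ w ∙ loop w v g ≈ g ∙ τ v
      τ-loop w v g = ≈-trans (≈-sym (assoc _ _ _)) (∙-congʳ
        (≈-trans (≈-sym (assoc _ _ _)) (≈-trans (∙-congʳ (inverseʳ _)) (identityˡ g))))

      loop-∙ : ∀ x y z g h → loop x y g ∙ loop y z h ≈ loop x z (g ∙ h)
      loop-∙ x y z g h = ∙-cancelˡ (τ x) _ _
        (≈-trans (≈-sym (assoc _ _ _)) (≈-trans (∙-congʳ (τ-loop x y g))
        (≈-trans (assoc _ _ _) (≈-trans (∙-congˡ (τ-loop y z h))
        (≈-trans (≈-sym (assoc _ _ _)) (≈-sym (τ-loop x z (g ∙ h))))))))
        where open GroupProperties group using (∙-cancelˡ)

      loop-stabilises : ∀ {s w v} g → g ▹ v ≡ w → rep w ≡ s → rep v ≡ s → loop w v g ▹ s ≡ s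
      loop-stabilises {s} {w} {v} g gv≡w refl v~s = begin
        (τ w ⁻¹ ∙ g ∙ τ v) ▹ s   ≡⟨ ∙-▹ (τ w ⁻¹ ∙ g) (τ v) s ⟩
        (τ w ⁻¹ ∙ g) ▹ τ v ▹ s   ≡⟨ cong (λ t → (τ w ⁻¹ ∙ g) ▹ τ v ▹ t) v~s ⟨
        (τ w ⁻¹ ∙ g) ▹ τ v ▹ rep v ≡⟨ cong ((τ w ⁻¹ ∙ g) ▹_) (τ-rep v) ⟩
        (τ w ⁻¹ ∙ g) ▹ v         ≡⟨ ∙-▹ (τ w ⁻¹) g v ⟩
        τ w ⁻¹ ▹ g ▹ v           ≡⟨ cong (τ w ⁻¹ ▹_) gv≡w ⟩
        τ w ⁻¹ ▹ w               ≡⟨ ⁻¹-▹ (τ-rep w) ⟩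
        rep w                    ∎
        where open ≡-Reasoning

      -- the cocycle φ of the stabiliser of s, transported to arrows v → w and
      -- changed by a coboundary
      Φ : Ω → Ω → Ω → Carrier → ℤ₄
      Φ s w v g = base w ⊕ twisted (κ θ (τ w)) (φ s (loop w v g)) ⊕ ⊖ twisted (κ θ g) (base v)

      Φ-lc : ∀ s w v → LocallyConstant (Φ s w v)
      Φ-lc s w v = lc-map₂ (λ x k → base w ⊕ twisted (κ θ (τ w)) x ⊕ ⊖ twisted k (base v))
        (lc-translate (proj₁ (proj₂ (stabiliser-lift s))) (τ w ⁻¹) (τ v)) (κ-lc θ)

      -- Loops compose by `loop-∙`, the terms in `base w₁` telescope, and the signs match because
      -- `κ` is multiplicative on both sides of `τ-loop`.
      Φ-∙ : ∀ {s w₂ w₁ w₀} g h → g ▹ w₁ ≡ w₂ → h ▹ w₀ ≡ w₁ → rep w₂ ≡ s → rep w₁ ≡ s → rep w₀ ≡ s →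
            Φ s w₂ w₀ (g ∙ h) ≡ Φ s w₂ w₁ g ⊕ twisted (κ θ g) (Φ s w₁ w₀ h)
      Φ-∙ {s} {w₂} {w₁} {w₀} g h e e′ r₂ r₁ r₀ =
        trans (cong₂ (λ x k → base w₂ ⊕ twisted (κ θ (τ w₂)) x ⊕ ⊖ twisted k (base w₀))
          (trans (sym (lc-resp (proj₁ (proj₂ (stabiliser-lift s))) (loop-∙ w₂ w₁ w₀ g h)))
                 (proj₂ (proj₂ (proj₂ (stabiliser-lift s)))
                    (stabilises⁺ (loop-stabilises g e r₂ r₁)) (stabilises⁺ (loop-stabilises h e′ r₁ r₀))))
          (κ-∙ θ g h))
        (table (κ θ (τ w₂)) (κ θ (loop w₂ w₁ g)) (κ θ g) (κ θ (τ w₁))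
          (trans (sym (κ-∙ θ (τ w₂) (loop w₂ w₁ g)))
                 (trans (lc-resp (κ-lc θ) (τ-loop w₂ w₁ g)) (κ-∙ θ g (τ w₁))))
          (κ θ h) (base w₂) (base w₁) (base w₀) (φ s (loop w₂ w₁ g)) (φ s (loop w₁ w₀ h)))
        where
        table : ∀ t k k′ t′ → t xor k ≡ k′ xor t′ → ∀ k″ x y z f f′ →
          x ⊕ twisted t (f ⊕ twisted k f′) ⊕ ⊖ twisted (k′ xor k″) z
          ≡ (x ⊕ twisted t f ⊕ ⊖ twisted k′ y) ⊕ twisted k′ (y ⊕ twisted t′ f′ ⊕ ⊖ twisted k″ z)
        table = decided (∀Bool? λ _ → ∀Bool? λ _ → ∀Bool? λ _ → ∀Bool? λ _ → (_ ≟ _) →-dec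
          (∀Bool? λ _ → ∀ℤ₄? λ _ → ∀ℤ₄? λ _ → ∀ℤ₄? λ _ → ∀ℤ₄? λ _ → ∀ℤ₄? λ _ → _ ≟₄ _))

      -- The cocycle `χ` obeys the relation coming from `τ-loop` as well, and its values on `τ w`
      -- and `τ v` are the low bits of `base`.
      lo-Φ : ∀ {s w v} g → g ▹ v ≡ w → rep w ≡ s → rep v ≡ s → lo (Φ s w v g) ≡ χ.fun g v
      lo-Φ {s} {w} {v} g gv≡w refl v~w = begin
        (χ.fun (τ w) s xor lo (φ s k)) xor χ.fun (τ v) (rep v)
          ≡⟨ cong₂ (λ x y → (χ.fun (τ w) s xor x) xor χ.fun (τ v) y)
               (proj₁ (proj₂ (proj₂ (stabiliser-lift s))) (stabilises⁺ ks≡s)) v~w ⟩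
        (χ.fun (τ w) s xor χ.fun k s) xor χ.fun (τ v) s
          ≡⟨ cong (λ x → (χ.fun (τ w) x xor χ.fun k s) xor χ.fun (τ v) s) ks≡s ⟨
        (χ.fun (τ w) (k ▹ s) xor χ.fun k s) xor χ.fun (τ v) s
          ≡⟨ cong (_xor χ.fun (τ v) s) (χ.∙-homo (τ w) k s) ⟨
        χ.fun (τ w ∙ k) s xor χ.fun (τ v) s
          ≡⟨ cong (_xor χ.fun (τ v) s) (trans (lc-resp (χ.lc s) (τ-loop w v g)) (χ.∙-homo g (τ v) s)) ⟩
        (χ.fun g (τ v ▹ s) xor χ.fun (τ v) s) xor χ.fun (τ v) s
          ≡⟨ cancel (χ.fun g (τ v ▹ s)) (χ.fun (τ v) s) ⟩
        χ.fun g (τ v ▹ s)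
          ≡⟨ cong (χ.fun g) (trans (cong (τ v ▹_) (sym v~w)) (τ-rep v)) ⟩
        χ.fun g v ∎
        where
        open ≡-Reasoning
        k : Carrier
        k = loop w v g
        ks≡s : k ▹ s ≡ s
        ks≡s = loop-stabilises g gv≡w refl v~w
        cancel : ∀ x y → (x xor y) xor y ≡ x
        cancel = decided (∀ⁿ? 2 λ _ _ → _ ≟ _)

    gset-hilbert90 : Σ[ F ∈ Cocycle₄ (κ θ) X ] (∀ g v → lo (Cocycle₄.fun F g v) ≡ χ.fun g v)
    gset-hilbert90 = record
      { fun = λ g v → Φ (rep v) (g ▹ v) v g
      -- The target `g ▹ v` varies with `g`, but is locally constant; `Φ` takes it as a separate
      -- argument so that it can be fixed first.
      ; lc = λ v → lc-bind (▹-lc v) (λ w → Φ-lc (rep v) w v)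
      ; ∙-homo = λ g h v → trans (cong (λ w → Φ (rep v) w v (g ∙ h)) (∙-▹ g h v))
          (trans (Φ-∙ g h refl refl (trans (rep-▹ g (h ▹ v)) (rep-▹ h v)) (rep-▹ h v) refl)
                 (cong (λ s → Φ s (g ▹ h ▹ v) (h ▹ v) g ⊕ twisted (κ θ g) (Φ (rep v) (h ▹ v) v h))
                       (sym (rep-▹ h v))))
      } , λ g v → lo-Φ g refl (rep-▹ g v) refl

  -- Cochains modulo 2 as Boolean functions

  private
    R : RawDGRing _ _
    R = cochainDGRing G (ℤ/ 2)

  open RawDGRing R hiding (_≈_)
  open Cochain using (fun; continuous)

  bits₁ : C 1 → Carrier → Bool
  bits₁ F g = parity (fun F (g ∷ []))

  bits₂ : C 2 → Carrier → Carrier → Bool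
  bits₂ F g h = parity (fun F (g ∷ h ∷ []))

  bits₁-lc : ∀ F → LocallyConstant (bits₁ F)
  bits₁-lc F x with near (U ∷ []) (Uo ∷ []) (x∈U ∷ []) c ← continuous F (x ∷ []) =
    U , Uo , x∈U , λ y∈U → parity-cong (c (y∈U ∷ []))

  cochain : (f : Carrier → Bool) → LocallyConstant f → C 1
  cochain f lf = record
    { fun = λ { (g ∷ []) → bit (f g) }
    ; cong = λ { {_ ∷ []} {_ ∷ []} (e ∷ []) → mod-reflexive 2 (cong bit (lc-resp lf e)) }
    ; continuous = λ { (g ∷ []) →
        let U , Uo , g∈U , c = lf g
        in near (U ∷ []) (Uo ∷ []) (g∈U ∷ [])
                λ { {_ ∷ []} (h∈U ∷ []) → mod-reflexive 2 (cong bit (c h∈U)) } }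
    }

  bits₂-∂ : ∀ F g h → bits₂ (∂ F) g h ≡ (bits₁ F g xor bits₁ F h) xor bits₁ F (g ∙ h)
  bits₂-∂ F g h = expand (fun F (g ∷ [])) (fun F (h ∷ [])) (fun F (g ∙ h ∷ []))
    where
    table : ∀ x y z → (y xor (z xor false)) xor x ≡ (x xor y) xor z
    table = decided (∀ⁿ? 3 λ _ _ _ → _ ≟ _)
    expand : ∀ x y z → parity (y ℤ.+ (ℤ.- z ℤ.+ 0ℤ) ℤ.+ ℤ.- (ℤ.- x)) ≡ (parity x xor parity y) xor parity z
    expand x y z = trans (parity-+ (y ℤ.+ (ℤ.- z ℤ.+ 0ℤ)) _) (trans
      (cong₂ _xor_ (trans (parity-+ y _) (cong (parity y xor_)
           (trans (parity-+ (ℤ.- z) 0ℤ) (cong (_xor false) (parity-neg z)))))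
           (trans (parity-neg (ℤ.- x)) (parity-neg x)))
      (table (parity x) (parity y) (parity z)))

  module _ (F : C 1) {Z : C 2} {r : Carrier → Carrier → Bool} (Z-bits : ∀ g h → bits₂ Z g h ≡ r g h) where

    ∂≈⇒∂≗ : (∀ x → fun (∂ F) x ≡ fun Z x [mod 2 ]) → bits₁ F ∂≗ r
    ∂≈⇒∂≗ e g h = table (bits₁ F g) (bits₁ F h) (bits₁ F (g ∙ h)) (r g h)
      (trans (sym (bits₂-∂ F g h)) (trans (parity-cong (e (g ∷ h ∷ []))) (Z-bits g h)))
      where
      table : ∀ x y z w → (x xor y) xor z ≡ w → z ≡ (x xor y) xor w
      table = decided (∀ⁿ? 4 λ _ _ _ _ → (_ ≟ _) →-dec (_ ≟ _))

    ∂≗⇒∂≈ : bits₁ F ∂≗ r → ∀ x → fun (∂ F) x ≡ fun Z x [mod 2 ]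
    ∂≗⇒∂≈ e (g ∷ h ∷ []) = parity-reflects (trans (bits₂-∂ F g h) (trans
      (table (bits₁ F g) (bits₁ F h) (bits₁ F (g ∙ h)) (r g h) (e g h)) (sym (Z-bits g h))))
      where
      table : ∀ x y z w → z ≡ (x xor y) xor w → (x xor y) xor z ≡ w
      table = decided (∀ⁿ? 4 λ _ _ _ _ → (_ ≟ _) →-dec (_ ≟ _))

  ⌣-bits : ∀ E F g h → bits₂ (E ⌣ F) g h ≡ (bits₁ E ∪ bits₁ F) g h
  ⌣-bits E F g h = parity-* (fun E (g ∷ [])) (fun F (h ∷ []))

  +-bits : ∀ {r s : Carrier → Carrier → Bool} (E F : C 2) →
            (∀ g h → bits₂ E g h ≡ r g h) → (∀ g h → bits₂ F g h ≡ s g h) →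
            ∀ g h → bits₂ (E + F) g h ≡ (r ⊹ s) g h
  +-bits E F e f g h = trans (parity-+ (fun E (g ∷ h ∷ [])) _) (cong₂ _xor_ (e g h) (f g h))

  +0-bits : ∀ {r : Carrier → Carrier → Bool} (E : C 2) →
            (∀ g h → bits₂ E g h ≡ r g h) → ∀ g h → bits₂ (E + 0#) g h ≡ r g h
  +0-bits E e g h = trans (parity-+ (fun E (g ∷ h ∷ [])) 0ℤ) (trans (xor-identityʳ _) (e g h))

  neg-bits : ∀ {r : Carrier → Carrier → Bool} (E : C 2) →
            (∀ g h → bits₂ E g h ≡ r g h) → ∀ g h → bits₂ (- E) g h ≡ r g h
  neg-bits E e g h = trans (parity-neg (fun E (g ∷ h ∷ []))) (e g h)

  ⌣₁-bits : ∀ E F g h → bits₂ (- (E ⌣ F + 0#)) g h ≡ (bits₁ E ∪ bits₁ F) g h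
  ⌣₁-bits E F = neg-bits (E ⌣ F + 0#) (+0-bits (E ⌣ F) (⌣-bits E F))

  ⌣₂-bits : ∀ E F E′ F′ g h →
    bits₂ (- (E ⌣ F + (E′ ⌣ F′ + 0#))) g h ≡ (bits₁ E ∪ bits₁ F ⊹ bits₁ E′ ∪ bits₁ F′) g h
  ⌣₂-bits E F E′ F′ = neg-bits (E ⌣ F + (E′ ⌣ F′ + 0#))
    (+-bits (E ⌣ F) (E′ ⌣ F′ + 0#) (⌣-bits E F) (+0-bits (E′ ⌣ F′) (⌣-bits E′ F′)))

  ∂-cochain : ∀ {f r} (lc-f : LC f) {Z : C 2} → (∀ g h → bits₂ Z g h ≡ r g h) → f ∂≗ r →
              RawDGRing._≈_ R (∂ (cochain f lc-f)) Z
  ∂-cochain {f} {r} lc-f {Z} Z-bits e = ∂≗⇒∂≈ (cochain f lc-f) {Z = Z} Z-bits λ g h →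
    trans (parity-bit (f (g ∙ h))) (trans (e g h)
      (cong (_xor r g h) (sym (cong₂ _xor_ (parity-bit (f g)) (parity-bit (f h))))))

  -- With trivial action the coboundary of a 0-cochain z is z - z, so cohomologous 1-cochains agree
  -- pointwise modulo 2.
  ∼⇒bits₁ : ∀ E F → E ∼ F → ∀ g → bits₁ E g ≡ bits₁ F g
  ∼⇒bits₁ E F (z , ∂z) g = expand (fun z []) (fun E (g ∷ [])) (fun F (g ∷ [])) (∂z (g ∷ []))
    where
    table : ∀ x e f → (x xor false) xor x ≡ e xor f → e ≡ f
    table = decided (∀ⁿ? 3 λ _ _ _ → (_ ≟ _) →-dec (_ ≟ _))
    expand : ∀ z e f → z ℤ.+ 0ℤ ℤ.+ ℤ.- z ≡ e ℤ.+ ℤ.- f [mod 2 ] → parity e ≡ parity f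
    expand z e f p = table (parity z) (parity e) (parity f) (begin
      (parity z xor false) xor parity z    ≡⟨ cong₂ _xor_ (parity-+ z 0ℤ) (parity-neg z) ⟨
      parity (z ℤ.+ 0ℤ) xor parity (ℤ.- z) ≡⟨ parity-+ (z ℤ.+ 0ℤ) (ℤ.- z) ⟨
      parity (z ℤ.+ 0ℤ ℤ.+ ℤ.- z)          ≡⟨ parity-cong p ⟩
      parity (e ℤ.+ ℤ.- f)                 ≡⟨ parity-+ e (ℤ.- f) ⟩
      parity e xor parity (ℤ.- f)          ≡⟨ cong (parity e xor_) (parity-neg f) ⟩
      parity e xor parity f                ∎)
      where open ≡-Reasoning

  -- Replacing entries of a defining system

  module DefiningSystem {χ₁ χ₂ χ₃ : H 1} {A : ℕ → ℕ → C 1}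
    (isA : IsDefiningSystem (χ₁ ∷ χ₂ ∷ χ₃ ∷ χ₁ ∷ []) A) where
    open IsDefiningSystem isA

    d : ℕ → ℕ → Carrier → Bool
    d i j = bits₁ (A i j)

    -- Both entries represent `χ₁`. This is the point at which the equality of the first and last
    -- classes of the product enters.
    d₄₅≗d₁₂ : ∀ g → d 4 5 g ≡ d 1 2 g
    d₄₅≗d₁₂ g = trans
      (∼⇒bits₁ (A 4 5) (proj₁ χ₁) (represents (Fin.suc (Fin.suc (Fin.suc Fin.zero)))) g)
      (sym (∼⇒bits₁ (A 1 2) (proj₁ χ₁) (represents Fin.zero) g))

    ∂d-simple : ∀ i → d (suc (Fin.toℕ i)) (suc (suc (Fin.toℕ i))) ∂≗ λ _ _ → false
    ∂d-simple i = ∂≈⇒∂≗ (A _ _) {Z = 0#} (λ _ _ → refl) (cocycle i)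

    ∂d₁₃ : d 1 3 ∂≗ d 1 2 ∪ d 2 3
    ∂d₁₃ = ∂≈⇒∂≗ (A 1 3) {Z = - (A 1 2 ⌣ A 2 3 + 0#)} (⌣₁-bits (A 1 2) (A 2 3))
      (boundary 1 3 (s≤s z≤n) (ℕ.m≤m+n 3 0) (ℕ.m≤m+n 3 2) λ ())

    ∂d₂₄ : d 2 4 ∂≗ d 2 3 ∪ d 3 4
    ∂d₂₄ = ∂≈⇒∂≗ (A 2 4) {Z = - (A 2 3 ⌣ A 3 4 + 0#)} (⌣₁-bits (A 2 3) (A 3 4))
      (boundary 2 4 (s≤s z≤n) (ℕ.m≤m+n 4 0) (ℕ.m≤m+n 4 1) λ ())

    ∂d₃₅ : d 3 5 ∂≗ d 3 4 ∪ d 1 2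
    ∂d₃₅ = ∂≈⇒∂≗ (A 3 5) {Z = - (A 3 4 ⌣ A 4 5 + 0#)}
      (λ g h → trans (⌣₁-bits (A 3 4) (A 4 5) g h) (cong (d 3 4 g ∧_) (d₄₅≗d₁₂ h)))
      (boundary 3 5 (s≤s z≤n) (ℕ.m≤m+n 5 0) (ℕ.m≤m+n 5 0) λ ())

    ∂d₁₄ : d 1 4 ∂≗ d 1 2 ∪ d 2 4 ⊹ d 1 3 ∪ d 3 4
    ∂d₁₄ = ∂≈⇒∂≗ (A 1 4) {Z = - (A 1 2 ⌣ A 2 4 + (A 1 3 ⌣ A 3 4 + 0#))}
      (⌣₂-bits (A 1 2) (A 2 4) (A 1 3) (A 3 4))
      (boundary 1 4 (s≤s z≤n) (ℕ.m≤m+n 3 1) (ℕ.m≤m+n 4 1) λ ())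

    ∂d₂₅ : d 2 5 ∂≗ d 2 3 ∪ d 3 5 ⊹ d 2 4 ∪ d 1 2
    ∂d₂₅ = ∂≈⇒∂≗ (A 2 5) {Z = - (A 2 3 ⌣ A 3 5 + (A 2 4 ⌣ A 4 5 + 0#))}
      (λ g h → trans (⌣₂-bits (A 2 3) (A 3 5) (A 2 4) (A 4 5) g h)
                     (cong (λ s → d 2 3 g ∧ d 3 5 h xor d 2 4 g ∧ s) (d₄₅≗d₁₂ h)))
      (boundary 2 5 (s≤s z≤n) (ℕ.m≤m+n 4 1) (ℕ.m≤m+n 5 0) λ ())

    module _ {x y z : Carrier → Bool} (lc-x : LC x) (lc-y : LC y) (lc-z : LC z)
      (∂x : x ∂≗ d 1 2 ∪ d 2 3) (∂y : y ∂≗ d 1 2 ∪ d 2 4 ⊹ x ∪ d 3 4)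
      (∂z : z ∂≗ d 1 2 ∪ d 2 5 ⊹ x ∪ d 3 5 ⊹ y ∪ d 1 2)
      where

      B₁₃ B₁₄ : C 1
      B₁₃ = cochain x lc-x
      B₁₄ = cochain y lc-y

      B : ℕ → ℕ → C 1
      B 1 3 = B₁₃
      B 1 4 = B₁₄
      B i j = A i j

      B-cocycle : (i : Fin 4) → IsCocycle (B (suc (Fin.toℕ i)) (suc (suc (Fin.toℕ i))))
      B-cocycle Fin.zero    = cocycle Fin.zero
      B-cocycle (Fin.suc i) = cocycle (Fin.suc i)

      B-represents : (i : Fin 4) → B (suc (Fin.toℕ i)) (suc (suc (Fin.toℕ i)))
                                   ∼ proj₁ (lookup (χ₁ ∷ χ₂ ∷ χ₃ ∷ χ₁ ∷ []) i)
      B-represents Fin.zero    = represents Fin.zero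
      B-represents (Fin.suc i) = represents (Fin.suc i)

      -- Only (1,3) and (1,4) call for a new verification. The pairs (2,4), (2,5) and (3,5) involve
      -- entries of `A` alone, (1,5) is excluded, and every other pair violates the bounds.
      B-boundary : ∀ i j → 1 ℕ.≤ i → suc i ℕ.< j → j ℕ.≤ 5 → ¬ (i ≡ 1 × j ≡ 5) →
                   RawDGRing._≈_ R (∂ (B i j)) (- ∑between i j (λ l → B i l ⌣ B l j))
      B-boundary 1 3 _ _ _ _ = ∂-cochain lc-x {Z = - (A 1 2 ⌣ A 2 3 + 0#)} (⌣₁-bits (A 1 2) (A 2 3)) ∂x
      B-boundary 1 4 _ _ _ _ = ∂-cochain lc-y {Z = - (A 1 2 ⌣ A 2 4 + (B₁₃ ⌣ A 3 4 + 0#))}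
        (λ g h → trans (⌣₂-bits (A 1 2) (A 2 4) B₁₃ (A 3 4) g h)
                       (cong (λ s → d 1 2 g ∧ d 2 4 h xor s ∧ d 3 4 h) (parity-bit (x g)))) ∂y
      B-boundary 1 5 _ _ _ ≢ = contradiction (refl , refl) ≢
      B-boundary 2 4 = boundary 2 4
      B-boundary 2 5 = boundary 2 5
      B-boundary 3 5 = boundary 3 5
      B-boundary 1 1 _ (s≤s ())
      B-boundary 1 2 _ (s≤s (s≤s ()))
      B-boundary 2 1 _ (s≤s ())
      B-boundary 2 2 _ (s≤s (s≤s ()))
      B-boundary 2 3 _ (s≤s (s≤s (s≤s ())))
      B-boundary 3 1 _ (s≤s ())
      B-boundary 3 2 _ (s≤s (s≤s ()))
      B-boundary 3 3 _ (s≤s (s≤s (s≤s ())))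
      B-boundary 3 4 _ (s≤s (s≤s (s≤s (s≤s ()))))
      B-boundary 1 (suc (suc (suc (suc (suc (suc j)))))) _ _ (s≤s (s≤s (s≤s (s≤s (s≤s ()))))) _
      B-boundary 2 (suc (suc (suc (suc (suc (suc j)))))) _ _ (s≤s (s≤s (s≤s (s≤s (s≤s ()))))) _
      B-boundary 3 (suc (suc (suc (suc (suc (suc j)))))) _ _ (s≤s (s≤s (s≤s (s≤s (s≤s ()))))) _
      B-boundary (suc (suc (suc (suc i)))) j _ i<j j≤5 _ =
        contradiction (ℕ.≤-trans i<j j≤5) λ { (s≤s (s≤s (s≤s (s≤s (s≤s ()))))) }

      B-value : value 4 B ∼ 0#
      -- The relation `∼` asks for a bound of `value 4 B + - 0#`, in which the added term computes
      -- to 0.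
      B-value = cochain z lc-z , ∂-cochain lc-z {Z = value 4 B + - 0#}
        (λ g h → trans (+0-bits (value 4 B) (λ _ _ → refl) g h)
        (trans (neg-bits (A 1 2 ⌣ A 2 5 + (B₁₃ ⌣ A 3 5 + (B₁₄ ⌣ A 4 5 + 0#)))
           (+-bits (A 1 2 ⌣ A 2 5) (B₁₃ ⌣ A 3 5 + (B₁₄ ⌣ A 4 5 + 0#)) (⌣-bits (A 1 2) (A 2 5))
           (+-bits (B₁₃ ⌣ A 3 5) (B₁₄ ⌣ A 4 5 + 0#) (⌣-bits B₁₃ (A 3 5))
           (+0-bits (B₁₄ ⌣ A 4 5) (⌣-bits B₁₄ (A 4 5))))) g h)
        (cong₂ (λ s t → d 1 2 g ∧ d 2 5 h xor s ∧ d 3 5 h xor t)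
           (parity-bit (x g)) (cong₂ _∧_ (parity-bit (y g)) (d₄₅≗d₁₂ h))))) ∂z

      corrected-vanishes : MasseyVanishes (χ₁ ∷ χ₂ ∷ χ₃ ∷ χ₁ ∷ [])
      corrected-vanishes =
        B , record { cocycle = B-cocycle ; represents = B-represents ; boundary = B-boundary } , B-value

    vanishes : (∀ {ℓ} → ExcludedMiddle ℓ) → (θ : Orientation 2 G) → FormalHilbert90 θ →
               MasseyVanishes (χ₁ ∷ χ₂ ∷ χ₃ ∷ χ₁ ∷ [])
    vanishes em θ hilbert90 =
      let x , y , z , lc-x , lc-y , lc-z , ∂x , ∂y , ∂z = Correction.correction
            (bits₁-lc (A 1 2)) (bits₁-lc (A 2 3)) (bits₁-lc (A 3 4)) (bits₁-lc (A 1 3))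
            (bits₁-lc (A 2 4)) (bits₁-lc (A 3 5)) (bits₁-lc (A 1 4)) (bits₁-lc (A 2 5))
            (∂d-simple Fin.zero) (∂d-simple (Fin.suc Fin.zero)) (∂d-simple (Fin.suc (Fin.suc Fin.zero)))
            ∂d₁₃ ∂d₂₄ ∂d₃₅ ∂d₁₄ ∂d₂₅ (OrbitLift.gset-hilbert90 em θ hilbert90)
      in corrected-vanishes {x} {y} {z} lc-x lc-y lc-z ∂x ∂y ∂z

theorem1p4 : (∀ {ℓ} → ExcludedMiddle ℓ) →
    ∀ {u : Level} (G : ProfiniteGroup u) →
    let open ProfiniteGroup G using (topologicalGroup)
        open RawDGRing (cochainDGRing topologicalGroup (ℤ/ 2)) in
    (θ : Orientation 2 topologicalGroup) → FormalHilbert90 θ →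
    (χ₁ χ₂ χ₃ : H 1) →
    MasseyDefined (χ₁ ∷ χ₂ ∷ χ₃ ∷ χ₁ ∷ []) →
    MasseyVanishes (χ₁ ∷ χ₂ ∷ χ₃ ∷ χ₁ ∷ [])
theorem1p4 em G θ hilbert90 χ₁ χ₂ χ₃ (_ , _ , isA , _) =
  DefiningSystem.vanishes (ProfiniteGroup.topologicalGroup G) isA em θ hilbert90
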